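{- Let $n\ge 1$ with $n\ne 2$. (a) The minimum number of nonzero entries of an $n\times n$ connected ASM equals $2n-1$ if $n$ is odd and $2n$ if $n$ is even. (b) If $n$ is odd, an $n\times n$ connected ASM $A$ has exactly $2n-1$ nonzero entries if and only if $A=I_1$ or $A$ can be obtained from $I_1$ by recursively attaching $D_3$'s, i.e., there is a sequence $I_1=A_0,A_1,\dots,A_t=A$ with each $A_{s+1}$ obtained from $A_s$ by attaching $D_3$. (c) If $n$ is even, an $n\times n$ connected ASM $A$ has exactly $2n$ nonzero entries if and only if $A$ is a basic unicyclic ASM or $A$ can be obtained from a basic unicyclic ASM by recursively attaching $D_3$'s.
   Context: An alternating sign matrix (ASM) is a square matrix with entries in $\{0,+1,-1\}$ such that in each row and each column the nonzero entries alternate in sign, beginning and ending with $+1$. For an $n\times n$ ASM $A=[a_{ij}]$, $BG(A)$ is the signed bipartite graph with vertex set $\{r_1,\dots,r_n\}\cup\{c_1,\dots,c_n\}$ having an edge $r_ic_j$ of sign $a_{ij}$ exactly when $a_{ij}\neq 0$; $A$ is connected if $BG(A)$ is connected. $I_1=[+1]$. $D_3=\begin{bmatrix}0&+1&0\\+1&-1&+1\\0&+1&0\end{bmatrix}$. Attaching $D_3$: given an $n\times n$ ASM $A$ and an entry $a_{ij}=+1$, an $(n+2)\times(n+2)$ matrix $B$ is obtained from $A$ by attaching $D_3$ if $B$ is an ASM and $B$ arises from $A$ by inserting two new rows and two new columns (anywhere, not necessarily consecutive, keeping the relative order of the old rows and columns) such that: there are rows $\rho_1<\rho_2<\rho_3$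 and columns $\gamma_1<\gamma_2<\gamma_3$ of $B$ with the $3\times 3$ submatrix of $B$ on these rows and columns equal to $D_3$; the entry of $B$ coming from $a_{ij}$ is one of the four $+1$ entries of this submatrix, its row and column are old and the other two of the $\rho$'s and other two of the $\gamma$'s are the new rows and columns; and all other entries of $B$ in the new rows and new columns are $0$. Basic unicyclic ASM: an $n\times n$ ASM $A$ such that $BG(A)$ consists of a cycle $C$ of length $2m$ with $m\ge 2$ (edges signed arbitrarily) together with, for each vertex $v$ of $C$: if both edges of $C$ at $v$ are positive, a new vertex $w$ joined to $v$ by a negative edge and two further new vertices joined to $w$ by positive edges; if exactly one edge of $C$ at $v$ is positive, one new vertex joined to $v$ by a positive edge; if both edges of $C$ at $v$ are negative, three new vertices joined to $v$ by positive edges; and no other vertices or edges. -}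

module Defs where

open import Data.Nat using (ℕ; zero; suc; _+_; _*_; _∸_; _≤_; _%_)
open import Data.Nat.DivMod using (_mod_)
open import Data.Integer using (ℤ; +_; -[1+_]; 0ℤ; 1ℤ; -1ℤ)
open import Data.Fin using (Fin; toℕ) renaming (_<_ to _<ᶠ_)
open import Data.Fin.Patterns using (0F; 1F; 2F)
open import Data.List using (List; []; _∷_; [_]; length; tabulate)
open import Data.Nat.ListAction using (sum)
open import Data.Bool using (Bool; true; false)
open import Data.Maybe using (Maybe; nothing; just)
open import Data.Product using (Σ; _×_; _,_; ∃)
open import Data.Sum using (_⊎_; inj₁; inj₂)
open import Data.Empty using (⊥)
open import Relation.Nullary using (¬_)
open import Relation.Binary.PropositionalEquality using (_≡_; _≢_)
open import Relation.Binary.Construct.Closure.ReflexiveTransitive using (Star)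
open import Function.Bundles using (_↔_; _⇔_; Inverse)

Matrix : ℕ → Set
Matrix n = Fin n → Fin n → ℤ

nonzeros : List ℤ → List ℤ
nonzeros [] = []
nonzeros (+ zero ∷ xs) = nonzeros xs
nonzeros (+ suc k ∷ xs) = + suc k ∷ nonzeros xs
nonzeros (-[1+ k ] ∷ xs) = -[1+ k ] ∷ nonzeros xs

data Alternating : List ℤ → Set where
  single : Alternating [ 1ℤ ]
  more   : ∀ {xs} → Alternating xs → Alternating (1ℤ ∷ -1ℤ ∷ xs)

row : ∀ {n} → Matrix n → Fin n → List ℤ
row A i = tabulate (λ j → A i j)

col : ∀ {n} → Matrix n → Fin n → List ℤ
col A j = tabulate (λ i → A i j)

record IsASM {n : ℕ} (A : Matrix n) : Set where
  field
    entries : ∀ i j → A i j ≡ 0ℤ ⊎ A i j ≡ 1ℤ ⊎ A i j ≡ -1ℤ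
    rowsAlt : ∀ i → Alternating (nonzeros (row A i))
    colsAlt : ∀ j → Alternating (nonzeros (col A j))

nnz : ∀ {n} → Matrix n → ℕ
nnz {n} A = sum (tabulate (λ i → length (nonzeros (row A i))))

-- The signed bipartite graph BG(A): vertices r_i = inj₁ i, c_j = inj₂ j;
-- BG A u v is the sign of the edge uv (0 = no edge).

Vtx : ℕ → Set
Vtx n = Fin n ⊎ Fin n

BG : ∀ {n} → Matrix n → Vtx n → Vtx n → ℤ
BG A (inj₁ i) (inj₂ j) = A i j
BG A (inj₂ j) (inj₁ i) = A i j
BG A (inj₁ _) (inj₁ _) = 0ℤ
BG A (inj₂ _) (inj₂ _) = 0ℤ

Adj : ∀ {n} → Matrix n → Vtx n → Vtx n → Set
Adj A u v = BG A u v ≢ 0ℤ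

Connected : ∀ {n} → Matrix n → Set
Connected {n} A = (u v : Vtx n) → Star (Adj A) u v

ConnectedASM : ∀ {n} → Matrix n → Set
ConnectedASM A = IsASM A × Connected A

I₁ : Matrix 1
I₁ _ _ = 1ℤ

D₃ : Fin 3 → Fin 3 → ℤ
D₃ 0F 1F = 1ℤ
D₃ 1F 0F = 1ℤ
D₃ 1F 1F = -1ℤ
D₃ 1F 2F = 1ℤ
D₃ 2F 1F = 1ℤ
D₃ _  _  = 0ℤ

StrictlyIncreasing : ∀ {m k} → (Fin m → Fin k) → Set
StrictlyIncreasing {m} f = ∀ (i j : Fin m) → i <ᶠ j → f i <ᶠ f j

New : ∀ {m k} → (Fin m → Fin k) → Fin k → Set
New σ r = ∀ i → σ i ≢ r

-- B is obtained from A by attaching D₃.  σ, τ embed the old rows/columns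
-- (order-preservingly) into the rows/columns of B; ρ, γ pick the rows
-- ρ₁<ρ₂<ρ₃ and columns γ₁<γ₂<γ₃ carrying the copy of D₃.
record AttachD₃ {n : ℕ} (A : Matrix n) (B : Matrix (suc (suc n))) : Set where
  field
    isASM   : IsASM B
    σ τ     : Fin n → Fin (suc (suc n))
    σ-inc   : StrictlyIncreasing σ
    τ-inc   : StrictlyIncreasing τ
    old     : ∀ i j → B (σ i) (τ j) ≡ A i j
    i j     : Fin n
    aij     : A i j ≡ 1ℤ
    ρ γ     : Fin 3 → Fin (suc (suc n))
    ρ-inc   : StrictlyIncreasing ρ
    γ-inc   : StrictlyIncreasing γ
    sub     : ∀ p q → B (ρ p) (γ q) ≡ D₃ p q
    p q     : Fin 3
    Dpq     : D₃ p q ≡ 1ℤ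
    ρp      : ρ p ≡ σ i
    γq      : γ q ≡ τ j
    ρ-new   : ∀ p′ → p′ ≢ p → New σ (ρ p′)
    γ-new   : ∀ q′ → q′ ≢ q → New τ (γ q′)
    zeros   : ∀ r c → (New σ r ⊎ New τ c) →
              ((∀ p′ → ρ p′ ≢ r) ⊎ (∀ q′ → γ q′ ≢ c)) → B r c ≡ 0ℤ

data AttachSeq {m : ℕ} (A : Matrix m) : (n : ℕ) → Matrix n → Set where
  base : ∀ {B : Matrix m} → (∀ i j → B i j ≡ A i j) → AttachSeq A m B
  step : ∀ {n} {B : Matrix n} {C : Matrix (suc (suc n))} →
         AttachSeq A n B → AttachD₃ B C → AttachSeq A (suc (suc n)) C

-- Basic unicyclic ASMs.
-- Cycle of length 2m with m = k + 2 ≥ 2, cycle vertices Fin (cycLen k);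
-- edge e_t joins v_t and v_{t+1 mod 2m}, its sign is s t (true = +).

cycLen : ℕ → ℕ
cycLen k = suc (suc k) + suc (suc k)

next prev : ∀ k → Fin (cycLen k) → Fin (cycLen k)
next k t = suc (toℕ t) mod cycLen k
prev k t = (toℕ t + suc (suc (suc (k + k)))) mod cycLen k   -- t - 1 mod 2m

sgn : Bool → ℤ
sgn true  = 1ℤ
sgn false = -1ℤ

data Kind : Set where
  PP Mixed NN : Kind

kindOf : Bool → Bool → Kind
kindOf true  true  = PP
kindOf false false = NN
kindOf _     _     = Mixed

kind : ∀ k → (Fin (cycLen k) → Bool) → Fin (cycLen k) → Kind
kind k s t = kindOf (s (prev k t)) (s t)

-- the new (pendant) vertices attached at a cycle vertex of a given kind
Deco : Kind → Set
Deco PP    = Fin 3    -- 0F = w, 1F and 2F = leaves at w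
Deco Mixed = Fin 1
Deco NN    = Fin 3

-- local signed edges: nothing = the cycle vertex itself
data LocalEdge : (κ : Kind) → Maybe (Deco κ) → Deco κ → ℤ → Set where
  pp-w  : LocalEdge PP nothing 0F -1ℤ
  pp-l1 : LocalEdge PP (just 0F) 1F 1ℤ
  pp-l2 : LocalEdge PP (just 0F) 2F 1ℤ
  mx    : LocalEdge Mixed nothing 0F 1ℤ
  nn    : ∀ x → LocalEdge NN nothing x 1ℤ

TVtx : ∀ k → (Fin (cycLen k) → Bool) → Set
TVtx k s = Fin (cycLen k) ⊎ Σ (Fin (cycLen k)) (λ t → Deco (kind k s t))

data TEdge (k : ℕ) (s : Fin (cycLen k) → Bool) : TVtx k s → TVtx k s → ℤ → Set where
  cyc   : ∀ t → TEdge k s (inj₁ t) (inj₁ (next k t)) (sgn (s t))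
  hub   : ∀ t x z → LocalEdge (kind k s t) nothing x z →
          TEdge k s (inj₁ t) (inj₂ (t , x)) z
  inner : ∀ t x y z → LocalEdge (kind k s t) (just x) y z →
          TEdge k s (inj₂ (t , x)) (inj₂ (t , y)) z

TAdj : ∀ k s → TVtx k s → TVtx k s → ℤ → Set
TAdj k s u v z = TEdge k s u v z ⊎ TEdge k s v u z

record IsBasicUnicyclic {n : ℕ} (A : Matrix n) : Set where
  field
    isASM : IsASM A
    k     : ℕ
    s     : Fin (cycLen k) → Bool
    iso   : Vtx n ↔ TVtx k s
    edges : ∀ u v z → z ≢ 0ℤ →
            (BG A u v ≡ z) ⇔ TAdj k s (Inverse.to iso u) (Inverse.to iso v) z

IsMinNNZ : ℕ → ℕ → Set
IsMinNNZ n m =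
  (Σ (Matrix n) λ A → ConnectedASM A × nnz A ≡ m) ×
  (∀ (A : Matrix n) → ConnectedASM A → m ≤ nnz A)

{-# OPTIONS --safe #-}
-- Call a vertex u of BG(A) a leaf if it has no negative edge, a hub if it has exactly one and all its
-- positive neighbours are leaves, and a core vertex otherwise. If next to a hub u on the line of its
-- negative neighbour v there is a leaf, then a D₃ centred at uv can be detached, leaving a smaller
-- connected ASM with four fewer nonzero entries. Otherwise (and if n > 1) the two positive entries
-- enclosing a negative entry of a hub lead to core vertices, and every core vertex has at least two
-- core neighbours. Charging each edge outside the core to its end farther from the core gives every
-- leaf and every hub one edge, so that BG(A) has at least as many edges as vertices, with equality
-- only if the core is 2-regular. A walk in the core that never turns back then closes up to a cycle,
-- and the signs of the two cycle edges at a core vertex determine the leaves and hubs hanging from it.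
module Submission where

open import Defs
open import Data.Bool using (Bool; true; false; not)
import Data.Bool.Properties as Bool
open import Data.Empty using (⊥)
open import Data.Fin using (Fin; zero; suc; toℕ; fromℕ<; punchIn; punchOut) renaming (_<_ to _<ᶠ_)
open import Data.Fin.Patterns using (0F; 1F; 2F; 3F)
import Data.Fin.Properties as Fin
open import Data.Integer using (ℤ; -[1+_]; 0ℤ; 1ℤ; -1ℤ) renaming (+_ to nonneg)
import Data.Integer.Properties as ℤ
open import Data.List using (List; []; _∷_; _++_; map; filter; length; tabulate; allFin; lookup)
import Data.List.Properties as List
open import Data.List.Membership.Propositional using (_∈_)
open import Data.List.Membership.Propositional.Properties
  using (∈-filter⁺; ∈-filter⁻; ∈-lookup; ∈-map⁺; ∈-map⁻; ∈-++⁺ˡ; ∈-++⁺ʳ; ∈-allFin)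
open import Data.List.Relation.Unary.All as All using ()
open import Data.List.Relation.Unary.AllPairs using ([]; _∷_)
open import Data.List.Relation.Unary.Any using (here; there; index)
open import Data.List.Relation.Unary.Any.Properties using (lookup-index)
open import Data.List.Relation.Unary.Unique.Propositional using (Unique)
import Data.List.Relation.Unary.Unique.Propositional.Properties as Unique
open import Data.Maybe using (Maybe; nothing; just)
open import Data.Nat using (ℕ; zero; suc; _+_; _*_; _∸_; _≤_; _<_; _%_; z≤n; s≤s; s≤s⁻¹)
open import Data.Nat.DivMod using (m<n⇒m%n≡m; n%n≡0; [m+n]%n≡m%n)
open import Data.Nat.ListAction using (sum)
import Data.Nat.ListAction.Properties as Sum
import Data.Nat.Properties as ℕ
open import Data.Nat.Solver using (module +-*-Solver)
open import Data.Product using (Σ; ∃; _×_; _,_; proj₁; proj₂)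
open import Data.Sum using (_⊎_; inj₁; inj₂; [_,_]′; swap)
import Data.Sum.Properties as Sum⊎
open import Function using (_∘_; id; case_of_)
open import Function.Bundles using (_⇔_; Inverse; Equivalence; mk↔ₛ′; mk⇔)
open import Relation.Binary.Construct.Closure.ReflexiveTransitive using (Star; ε; _◅_; _◅◅_; gmap; reverse)
open import Relation.Binary.PropositionalEquality
open import Relation.Binary.Definitions using (tri<; tri≈; tri>)
open import Relation.Nullary using (¬_; Dec; yes; no; does; contradiction)
open import Relation.Nullary.Decidable using (decidable-stable; _×-dec_; _⊎-dec_; _→-dec_; ¬?; map′)

-- Finite sums and enumerations

-- Attaching a `D₃` adds 4 nonzero entries and 2 to the size, so nnz - 2n never changes: it is -1
-- for everything grown from `I₁` and 0 for everything grown from a basic unicyclic matrix. One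
-- dichotomy, `Classified`, therefore serves both parities and is carried along attachments; parity
-- is used to discard its first alternative for even n, since growth from `I₁` gives odd sizes only.
-- The obstacle is that a hub cannot always be removed. Detaching takes away the hub u, its two
-- leaves and a leaf w of the line of v, which are two rows and two columns; but the line of v must
-- keep alternating, so the entries lost there have to be consecutive. Hence w must be next to u.
-- Where no such leaf exists, the entries beside u are forced into the core, and this order
-- information, invisible in the abstract graph, gives core vertices their second core neighbour and
-- so rules out trees.

∑ : {X : Set} → List X → (X → ℕ) → ℕ
∑ L f = sum (map f L)

ind : {P : Set} → Dec P → ℕ
ind (yes _) = 1
ind (no _)  = 0

ind-yes : {P : Set} (d : Dec P) → P → ind d ≡ 1
ind-yes (yes _) _ = refl
ind-yes (no ¬p) p = contradiction p ¬p

ind-no : {P : Set} (d : Dec P) → ¬ P → ind d ≡ 0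
ind-no (yes p) ¬p = contradiction p ¬p
ind-no (no _)  _  = refl

module _ {X : Set} where

  ∑-cong : ∀ (L : List X) {f g} → (∀ x → f x ≡ g x) → ∑ L f ≡ ∑ L g
  ∑-cong L eq = cong sum (List.map-cong eq L)

  ∑-+ : ∀ (L : List X) f g → ∑ L (λ x → f x + g x) ≡ ∑ L f + ∑ L g
  ∑-+ []      f g = refl
  ∑-+ (x ∷ L) f g rewrite ∑-+ L f g =
    solve 4 (λ a b c d → (a :+ b) :+ (c :+ d) := (a :+ c) :+ (b :+ d)) refl
      (f x) (g x) (∑ L f) (∑ L g)
    where open +-*-Solver

  ∑-const : ∀ (L : List X) c → ∑ L (λ _ → c) ≡ length L * c
  ∑-const []      c = refl
  ∑-const (_ ∷ L) c = cong (c +_) (∑-const L c)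

  ∑-zero : ∀ (L : List X) {f} → (∀ x → f x ≡ 0) → ∑ L f ≡ 0
  ∑-zero L {f} eq = trans (∑-cong L eq) (trans (∑-const L 0) (ℕ.*-zeroʳ (length L)))

  ∑-mono-≤ : ∀ (L : List X) {f g} → (∀ x → f x ≤ g x) → ∑ L f ≤ ∑ L g
  ∑-mono-≤ []      le = z≤n
  ∑-mono-≤ (x ∷ L) le = ℕ.+-mono-≤ (le x) (∑-mono-≤ L le)

  -- The equality case of a termwise estimate: once the totals leave no slack, no single term has
  -- any. It turns the count nnz = 2n into local information at every vertex.
  ∑-tight : ∀ (L : List X) {f g} → (∀ x → g x ≤ f x) → ∑ L f ≤ ∑ L g →
            ∀ {x} → x ∈ L → f x ≤ g x
  ∑-tight (x ∷ L) {f} {g} le tot (here refl) =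
    ℕ.+-cancelʳ-≤ (∑ L f) (f x) (g x) (ℕ.≤-trans tot (ℕ.+-monoʳ-≤ (g x) (∑-mono-≤ L le)))
  ∑-tight (y ∷ L) {f} {g} le tot (there x∈) =
    ∑-tight L le (ℕ.+-cancelˡ-≤ (f y) _ _ (ℕ.≤-trans tot (ℕ.+-monoˡ-≤ (∑ L g) (le y)))) x∈

  ∑-ind : ∀ {P : X → Set} (P? : ∀ x → Dec (P x)) L → ∑ L (ind ∘ P?) ≡ length (filter P? L)
  ∑-ind P? []      = refl
  ∑-ind P? (x ∷ L) with P? x
  ... | yes _ = cong suc (∑-ind P? L)
  ... | no  _ = ∑-ind P? L

∑-comm : {X Y : Set} (L : List X) (M : List Y) (f : X → Y → ℕ) →
         ∑ L (λ x → ∑ M (f x)) ≡ ∑ M (λ y → ∑ L (λ x → f x y))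
∑-comm []      M f = sym (∑-zero M (λ _ → refl))
∑-comm (x ∷ L) M f =
  trans (cong (∑ M (f x) +_) (∑-comm L M f)) (sym (∑-+ M (f x) (λ y → ∑ L (λ x → f x y))))

-- A cardinality together with its witnesses. It is passed through in both directions: a number
-- known from the balance of a line yields named vertices, and a named list of vertices fixes a
-- number by `enum-size`.
record Enum {X : Set} (k : ℕ) (P : X → Set) : Set where
  field
    at     : Fin k → X
    at-inj : ∀ {i j} → at i ≡ at j → i ≡ j
    at-sat : ∀ i → P (at i)
    at-all : ∀ x → P x → ∃ λ i → at i ≡ x

enum-≥ : ∀ {X : Set} {P : X → Set} {k l} → Enum l P → (e : Fin k → X) →
         (∀ {i j} → e i ≡ e j → i ≡ j) → (∀ i → P (e i)) → k ≤ l
enum-≥ E e e-inj e-sat = Fin.injective⇒≤ {f = λ i → proj₁ (at-all (e i) (e-sat i))}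
  (λ {i} {j} eq → e-inj (trans (sym (proj₂ (at-all (e i) (e-sat i))))
    (trans (cong at eq) (proj₂ (at-all (e j) (e-sat j))))))
  where open Enum E

enum-size : ∀ {X : Set} {P : X → Set} {k l} → Enum k P → Enum l P → k ≡ l
enum-size E F = ℕ.≤-antisym (enum-≥ F (at E) (at-inj E) (at-sat E))
                            (enum-≥ E (at F) (at-inj F) (at-sat F))
  where open Enum

record Listing (X : Set) : Set where
  field
    els    : List X
    unique : Unique els
    all∈   : ∀ x → x ∈ els

lookup-inj : ∀ {X : Set} {L : List X} → Unique L → ∀ {i j} → lookup L i ≡ lookup L j → i ≡ j
lookup-inj (px ∷ u) {zero}  {zero}  eq = refl
lookup-inj (px ∷ u) {zero}  {suc j} eq = contradiction eq (All.lookup px (∈-lookup j))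
lookup-inj (px ∷ u) {suc i} {zero}  eq = contradiction (sym eq) (All.lookup px (∈-lookup i))
lookup-inj (px ∷ u) {suc i} {suc j} eq = cong suc (lookup-inj u eq)

module Counting {X : Set} (fin : Listing X) where
  open Listing fin

  # : {P : X → Set} → (∀ x → Dec (P x)) → ℕ
  # P? = ∑ els (ind ∘ P?)

  module _ {P : X → Set} (P? : ∀ x → Dec (P x)) where

    abstract
      #-enum : Enum (# P?) P
      #-enum = subst (λ k → Enum k P) (sym (∑-ind P? els)) record
        { at     = lookup (filter P? els)
        ; at-inj = lookup-inj (Unique.filter⁺ P? unique)
        ; at-sat = λ i → proj₂ (∈-filter⁻ P? {xs = els} (∈-lookup i))
        ; at-all = λ x px → let m = ∈-filter⁺ P? (all∈ x) px in index m , sym (lookup-index m)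
        }

      #-≥ : ∀ {k} (e : Fin k → X) → (∀ {i j} → e i ≡ e j → i ≡ j) → (∀ i → P (e i)) → k ≤ # P?
      #-≥ = enum-≥ #-enum

    #-≥1 : ∀ {x} → P x → 1 ≤ # P?
    #-≥1 {x} px = #-≥ {1} (λ _ → x) (λ { {0F} {0F} _ → refl }) (λ _ → px)

    #-≥2 : ∀ {x y} → P x → P y → x ≢ y → 2 ≤ # P?
    #-≥2 {x} {y} px py x≢y = #-≥ {2} (λ { 0F → x ; 1F → y })
      (λ { {0F} {0F} _ → refl ; {0F} {1F} e → contradiction e x≢y
         ; {1F} {0F} e → contradiction (sym e) x≢y ; {1F} {1F} _ → refl })
      (λ { 0F → px ; 1F → py })

    #-0⇒none : # P? ≡ 0 → ∀ x → ¬ P x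
    #-0⇒none eq x px = ℕ.n≮n 0 (subst (1 ≤_) eq (#-≥1 px))

    #-1⇒unique : # P? ≡ 1 → ∀ {x y} → P x → P y → Dec (x ≡ y) → x ≡ y
    #-1⇒unique eq px py (yes x≡y) = x≡y
    #-1⇒unique eq px py (no  x≢y) = contradiction (subst (2 ≤_) eq (#-≥2 px py x≢y)) λ { (s≤s ()) }

    #-∃ : 1 ≤ # P? → ∃ P
    #-∃ le = at (fromℕ< le) , at-sat (fromℕ< le)
      where open Enum #-enum

    #-2⇒either : (∀ x y → Dec (x ≡ y)) → # P? ≡ 2 → ∀ {x y z} → x ≢ y → P x → P y → P z →
                 z ≡ x ⊎ z ≡ y
    #-2⇒either _≟_ two {x} {y} {z} x≢y px py pz with z ≟ x | z ≟ y
    ... | yes e | _     = inj₁ e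
    ... | no _  | yes e = inj₂ e
    ... | no z≢x | no z≢y =
      contradiction (subst (3 ≤_) two (#-≥ e e-inj λ { 0F → px ; 1F → py ; 2F → pz }))
                    λ { (s≤s (s≤s ())) }
      where
      e : Fin 3 → X
      e 0F = x
      e 1F = y
      e 2F = z

      e-inj : ∀ {i j} → e i ≡ e j → i ≡ j
      e-inj {0F} {0F} _ = refl
      e-inj {0F} {1F} q = contradiction q x≢y
      e-inj {0F} {2F} q = contradiction (sym q) z≢x
      e-inj {1F} {0F} q = contradiction (sym q) x≢y
      e-inj {1F} {1F} _ = refl
      e-inj {1F} {2F} q = contradiction (sym q) z≢y
      e-inj {2F} {0F} q = contradiction q z≢x
      e-inj {2F} {1F} q = contradiction q z≢y
      e-inj {2F} {2F} _ = refl

-- Alternating lines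

nz : ∀ {n} → (Fin n → ℤ) → List ℤ
nz f = nonzeros (tabulate f)

Gap : ∀ {n} → (Fin n → ℤ) → Fin n → Fin n → Set
Gap f a b = ∀ w → a <ᶠ w → w <ᶠ b → f w ≡ 0ℤ

alt-head : ∀ {x xs} → Alternating (x ∷ xs) → x ≡ 1ℤ
alt-head single   = refl
alt-head (more _) = refl

alt-second : ∀ {x y xs} → Alternating (x ∷ y ∷ xs) → y ≡ -1ℤ × Alternating xs
alt-second (more a) = refl , a

nonzeros-∷ : ∀ {x} xs → x ≢ 0ℤ → nonzeros (x ∷ xs) ≡ x ∷ nonzeros xs
nonzeros-∷ {nonneg zero}    xs x≢0 = contradiction refl x≢0
nonzeros-∷ {nonneg (suc _)} xs x≢0 = refl
nonzeros-∷ { -[1+ _ ]}      xs x≢0 = refl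

nonzeros-∷-cong : ∀ x {xs ys} → nonzeros xs ≡ nonzeros ys → nonzeros (x ∷ xs) ≡ nonzeros (x ∷ ys)
nonzeros-∷-cong (nonneg zero)    eq = eq
nonzeros-∷-cong (nonneg (suc k)) eq = cong (nonneg (suc k) ∷_) eq
nonzeros-∷-cong -[1+ k ]         eq = cong (-[1+ k ] ∷_) eq

∑-nonzeros : ∀ xs {f : ℤ → ℕ} → f 0ℤ ≡ 0 → ∑ (nonzeros xs) f ≡ ∑ xs f
∑-nonzeros []                   f0 = refl
∑-nonzeros (nonneg zero ∷ xs)   {f} f0 = trans (∑-nonzeros xs f0) (cong (λ z → z + ∑ xs f) (sym f0))
∑-nonzeros (nonneg (suc k) ∷ xs) {f} f0 = cong (λ z → f (nonneg (suc k)) + z) (∑-nonzeros xs f0)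
∑-nonzeros (-[1+ k ] ∷ xs)      {f} f0 = cong (λ z → f -[1+ k ] + z) (∑-nonzeros xs f0)

length-nonzeros : ∀ xs → length (nonzeros xs) ≡ ∑ xs (λ x → ind (¬? (x ℤ.≟ 0ℤ)))
length-nonzeros []                    = refl
length-nonzeros (nonneg zero ∷ xs)    = length-nonzeros xs
length-nonzeros (nonneg (suc _) ∷ xs) = cong suc (length-nonzeros xs)
length-nonzeros (-[1+ _ ] ∷ xs)       = cong suc (length-nonzeros xs)

alt-balance : ∀ {xs} → Alternating xs →
              ∑ xs (λ x → ind (x ℤ.≟ 1ℤ)) ≡ suc (∑ xs (λ x → ind (x ℤ.≟ -1ℤ)))
alt-balance single   = refl
alt-balance (more a) = cong suc (alt-balance a)

line-balance : ∀ xs → Alternating (nonzeros xs) →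
               ∑ xs (λ x → ind (x ℤ.≟ 1ℤ)) ≡ suc (∑ xs (λ x → ind (x ℤ.≟ -1ℤ)))
line-balance xs a =
  trans (sym (∑-nonzeros xs refl)) (trans (alt-balance a) (cong suc (∑-nonzeros xs refl)))

first-positive : ∀ {n} (f : Fin n → ℤ) → Alternating (nz f) →
                 ∃ λ z → f z ≡ 1ℤ × (∀ w → w <ᶠ z → f w ≡ 0ℤ)
first-positive {suc n} f a with f zero in eq
... | nonneg zero with z , fz , gap ← first-positive (f ∘ suc) a =
      suc z , fz , λ { zero _ → eq ; (suc w) w<z → gap w (s≤s⁻¹ w<z) }
... | nonneg (suc k) = zero , trans eq (alt-head a) , λ _ ()
... | -[1+ k ] with () ← alt-head a

module _ where
  private
    suc-next : ∀ {n} {f : Fin (suc n) → ℤ} {x} →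
               (∃ λ z → x <ᶠ z × f (suc z) ≡ 1ℤ × Gap (f ∘ suc) x z) →
               ∃ λ z → suc x <ᶠ z × f z ≡ 1ℤ × Gap f (suc x) z
    suc-next (z , x<z , fz , gap) =
      suc z , s≤s x<z , fz , λ { (suc w) x<w w<z → gap w (s≤s⁻¹ x<w) (s≤s⁻¹ w<z) }

  next-positive  : ∀ {n} (f : Fin n → ℤ) {x} → Alternating (nz f) → f x ≡ -1ℤ →
                   ∃ λ z → x <ᶠ z × f z ≡ 1ℤ × Gap f x z
  -- The prime marks the state after a +1 has been read: the leading `1ℤ` stands for it, so the next
  -- nonzero entry of `f` can only be -1. The two functions alternate along the line.
  next-positive′ : ∀ {n} (f : Fin n → ℤ) {x} → Alternating (1ℤ ∷ nz f) → f x ≡ -1ℤ →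
                   ∃ λ z → x <ᶠ z × f z ≡ 1ℤ × Gap f x z

  next-positive {suc n} f {zero} a fx rewrite fx with () ← alt-head a
  next-positive {suc n} f {suc x} a fx with f zero
  ... | nonneg zero    = suc-next (next-positive (f ∘ suc) a fx)
  ... | nonneg (suc k) with refl ← alt-head a = suc-next (next-positive′ (f ∘ suc) a fx)
  ... | -[1+ k ]       with () ← alt-head a

  next-positive′ {suc n} f {zero} a fx rewrite fx
    with z , fz , gap ← first-positive (f ∘ suc) (proj₂ (alt-second a)) =
      suc z , s≤s z≤n , fz , λ { (suc w) _ w<z → gap w (s≤s⁻¹ w<z) }
  next-positive′ {suc n} f {suc x} a fx with f zero
  ... | nonneg zero    = suc-next (next-positive′ (f ∘ suc) a fx)
  ... | nonneg (suc k) with () ← proj₁ (alt-second a)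
  ... | -[1+ k ]       = suc-next (next-positive (f ∘ suc) (proj₂ (alt-second a)) fx)

module _ where
  private
    suc-prev : ∀ {n} {f : Fin (suc n) → ℤ} {x} →
               (∃ λ z → z <ᶠ x × f (suc z) ≡ 1ℤ × Gap (f ∘ suc) z x) →
               ∃ λ z → z <ᶠ suc x × f z ≡ 1ℤ × Gap f z (suc x)
    suc-prev (z , x<z , fz , gap) =
      suc z , s≤s x<z , fz , λ { (suc w) x<w w<z → gap w (s≤s⁻¹ x<w) (s≤s⁻¹ w<z) }

  prev-positive  : ∀ {n} (f : Fin n → ℤ) {x} → Alternating (nz f) → f x ≡ -1ℤ →
                   ∃ λ z → z <ᶠ x × f z ≡ 1ℤ × Gap f z x
  -- The pending +1 lies before `f`, so it may itself be the entry sought. This happens exactly when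
  -- `f` vanishes before `x`, which is the left alternative.
  prev-positive′ : ∀ {n} (f : Fin n → ℤ) {x} → Alternating (1ℤ ∷ nz f) → f x ≡ -1ℤ →
                   (∀ w → w <ᶠ x → f w ≡ 0ℤ) ⊎ (∃ λ z → z <ᶠ x × f z ≡ 1ℤ × Gap f z x)

  prev-positive {suc n} f {zero} a fx rewrite fx with () ← alt-head a
  prev-positive {suc n} f {suc x} a fx with f zero in eq
  ... | nonneg zero    = suc-prev (prev-positive (f ∘ suc) a fx)
  ... | -[1+ k ]       with () ← alt-head a
  ... | nonneg (suc k) with refl ← alt-head a with prev-positive′ (f ∘ suc) a fx
  ...   | inj₁ none = zero , s≤s z≤n , eq , λ { (suc w) _ w<x → none w (s≤s⁻¹ w<x) }
  ...   | inj₂ r    = suc-prev r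

  prev-positive′ {suc n} f {zero} a fx = inj₁ λ _ ()
  prev-positive′ {suc n} f {suc x} a fx with f zero in eq
  ... | nonneg (suc k) with () ← proj₁ (alt-second a)
  ... | -[1+ k ]       = inj₂ (suc-prev (prev-positive (f ∘ suc) (proj₂ (alt-second a)) fx))
  ... | nonneg zero with prev-positive′ (f ∘ suc) a fx
  ...   | inj₁ none = inj₁ λ { zero _ → eq ; (suc w) w<x → none w (s≤s⁻¹ w<x) }
  ...   | inj₂ r    = inj₂ (suc-prev r)

nz-punchIn-zero : ∀ {n} (f : Fin (suc n) → ℤ) x → f x ≡ 0ℤ → nz (f ∘ punchIn x) ≡ nz f
nz-punchIn-zero f zero fx rewrite fx = refl
nz-punchIn-zero {suc n} f (suc x) fx =
  nonzeros-∷-cong (f zero) (nz-punchIn-zero (f ∘ suc) x fx)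

nz-punchIn-first : ∀ {n} (f : Fin (suc n) → ℤ) x → f x ≢ 0ℤ → (∀ w → w <ᶠ x → f w ≡ 0ℤ) →
                   nz f ≡ f x ∷ nz (f ∘ punchIn x)
nz-punchIn-first f zero fx none = nonzeros-∷ _ fx
nz-punchIn-first {suc n} f (suc x) fx none rewrite none zero (s≤s z≤n) =
  nz-punchIn-first (f ∘ suc) x fx (λ w w<x → none (suc w) (s≤s w<x))

skip : ∀ {n} {a b : Fin (suc (suc n))} → a ≢ b → Fin n → Fin (suc (suc n))
skip {a = a} a≢b i = punchIn a (punchIn (punchOut a≢b) i)

nz-skip-zeros : ∀ {n} (f : Fin (suc (suc n)) → ℤ) {a b} (a≢b : a ≢ b) → f a ≡ 0ℤ → f b ≡ 0ℤ →
                nz (f ∘ skip a≢b) ≡ nz f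
nz-skip-zeros f {a} a≢b fa fb =
  trans (nz-punchIn-zero (f ∘ punchIn a) (punchOut a≢b) (trans (cong f (Fin.punchIn-punchOut a≢b)) fb))
        (nz-punchIn-zero f a fa)

data Cut (x y : ℤ) : List ℤ → List ℤ → Set where
  here  : ∀ {zs} → Cut x y (x ∷ y ∷ zs) zs
  there : ∀ {z zs ws} → Cut x y zs ws → Cut x y (z ∷ zs) (z ∷ ws)

cut⁺⁻-alt : ∀ {xs ys} → Cut 1ℤ -1ℤ xs ys → Alternating xs → Alternating ys
cut⁺⁻-alt here              (more a) = a
cut⁺⁻-alt (there (there c)) (more a) = more (cut⁺⁻-alt c a)

cut⁻⁺-alt : ∀ {xs ys} → Cut -1ℤ 1ℤ xs ys → Alternating xs → Alternating ys
cut⁻⁺-alt (there here)      (more a) = a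
cut⁻⁺-alt (there (there c)) (more a) = more (cut⁻⁺-alt c a)

cut-∷ : ∀ {x y} z {xs ys} → Cut x y (nonzeros xs) (nonzeros ys) →
        Cut x y (nonzeros (z ∷ xs)) (nonzeros (z ∷ ys))
cut-∷ (nonneg zero)    c = c
cut-∷ (nonneg (suc _)) c = there c
cut-∷ -[1+ _ ]         c = there c

-- The `Gap` makes two nonzero entries of the line consecutive once the zeros are discarded, so
-- removing the two positions from the index set is a `Cut` of the list.
cut-skip : ∀ {n} (f : Fin (suc (suc n)) → ℤ) {a b} (a≢b : a ≢ b) → a <ᶠ b →
           f a ≢ 0ℤ → f b ≢ 0ℤ → Gap f a b → Cut (f a) (f b) (nz f) (nz (f ∘ skip a≢b))
cut-skip f {zero} {suc b} a≢b a<b fa fb gap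
  rewrite nonzeros-∷ (tabulate (f ∘ suc)) fa
        | nz-punchIn-first (f ∘ suc) b fb (λ w w<b → gap (suc w) (s≤s z≤n) (s≤s w<b)) = here
cut-skip {zero} f {suc 0F} {suc 0F} a≢b (s≤s ()) fa fb gap
cut-skip {suc n} f {suc a} {suc b} a≢b a<b fa fb gap =
  cut-∷ (f zero) (cut-skip (f ∘ suc) (a≢b ∘ cong suc) (s≤s⁻¹ a<b) fa fb
    (λ w a<w w<b → gap (suc w) (s≤s a<w) (s≤s w<b)))

-- The signed graph of a matrix

_≟ᵛ_ : ∀ {n} (u v : Vtx n) → Dec (u ≡ v)
_≟ᵛ_ = Sum⊎.≡-dec Fin._≟_ Fin._≟_

vertices : ∀ n → Listing (Vtx n)
vertices n = record
  { els    = map inj₁ (allFin n) ++ map inj₂ (allFin n)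
  ; unique = Unique.++⁺ (Unique.map⁺ Sum⊎.inj₁-injective (Unique.allFin⁺ n))
                        (Unique.map⁺ Sum⊎.inj₂-injective (Unique.allFin⁺ n)) disjoint
  ; all∈   = λ { (inj₁ i) → ∈-++⁺ˡ (∈-map⁺ inj₁ (∈-allFin i))
               ; (inj₂ j) → ∈-++⁺ʳ (map inj₁ (allFin n)) (∈-map⁺ inj₂ (∈-allFin j)) }
  }
  where
  disjoint : ∀ {v : Vtx n} → ¬ (v ∈ map inj₁ (allFin n) × v ∈ map inj₂ (allFin n))
  disjoint (p , q) with ∈-map⁻ inj₁ p | ∈-map⁻ inj₂ q
  ... | _ , _ , refl | _ , _ , ()

module _ {n : ℕ} {P : Vtx n → Set} (P? : ∀ v → Dec (P v)) where

  allᵛ? : Dec (∀ v → P v)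
  allᵛ? = map′ (λ (f , g) → λ { (inj₁ i) → f i ; (inj₂ j) → g j }) (λ h → (h ∘ inj₁) , (h ∘ inj₂))
            (Fin.all? (P? ∘ inj₁) ×-dec Fin.all? (P? ∘ inj₂))

  anyᵛ? : Dec (∃ P)
  anyᵛ? = map′ (λ { (inj₁ (i , p)) → inj₁ i , p ; (inj₂ (j , p)) → inj₂ j , p })
               (λ { (inj₁ i , p) → inj₁ (i , p) ; (inj₂ j , p) → inj₂ (j , p) })
               (Fin.any? (P? ∘ inj₁) ⊎-dec Fin.any? (P? ∘ inj₂))

∑-tabulate : ∀ {X : Set} {n} (g : Fin n → X) f → ∑ (tabulate g) f ≡ ∑ (allFin n) (f ∘ g)
∑-tabulate g f = cong sum (trans (List.map-tabulate g f) (sym (List.map-tabulate id (f ∘ g))))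

∑-vertices : ∀ n f → ∑ (Listing.els (vertices n)) f ≡
             ∑ (allFin n) (f ∘ inj₁) + ∑ (allFin n) (f ∘ inj₂)
∑-vertices n f =
  trans (cong sum (List.map-++ f (map inj₁ (allFin n)) (map inj₂ (allFin n))))
  (trans (Sum.sum-++ (map f (map inj₁ (allFin n))) _)
  (cong₂ _+_ (cong sum (sym (List.map-∘ (allFin n)))) (cong sum (sym (List.map-∘ (allFin n))))))

nonzero : ℤ → ℕ
nonzero x = ind (¬? (x ℤ.≟ 0ℤ))

nnz-∑ : ∀ {n} (A : Matrix n) → nnz A ≡ ∑ (allFin n) (λ i → ∑ (allFin n) (λ j → nonzero (A i j)))
nnz-∑ {n} A =
  trans (cong sum (sym (List.map-tabulate id (λ i → length (nonzeros (row A i))))))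
    (∑-cong (allFin n) (λ i → trans (length-nonzeros (row A i)) (∑-tabulate (A i) nonzero)))

-- The position of a vertex on any line that meets it. Forgetting the side lets order statements
-- such as `Near` treat rows and columns alike.
ix : ∀ {n} → Vtx n → ℕ
ix (inj₁ i) = toℕ i
ix (inj₂ j) = toℕ j

module Graph {n : ℕ} (A : Matrix n) where

  open Counting (vertices n) public
  open Listing (vertices n) public

  infix 8 _∙_
  _∙_ : Vtx n → Vtx n → ℤ
  u ∙ v = BG A u v

  ∙-sym : ∀ u v → u ∙ v ≡ v ∙ u
  ∙-sym (inj₁ _) (inj₁ _) = refl
  ∙-sym (inj₁ _) (inj₂ _) = refl
  ∙-sym (inj₂ _) (inj₁ _) = refl
  ∙-sym (inj₂ _) (inj₂ _) = refl

  ∙-sym-≡ : ∀ {u v z} → u ∙ v ≡ z → v ∙ u ≡ z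
  ∙-sym-≡ {u} {v} eq = trans (∙-sym v u) eq

  adj-sym : ∀ {u v} → Adj A u v → Adj A v u
  adj-sym {u} {v} adj eq = adj (∙-sym-≡ {v} {u} eq)

  adj⁺ : ∀ {u v} → u ∙ v ≡ 1ℤ → Adj A u v
  adj⁺ eq eq′ with () ← trans (sym eq) eq′

  adj⁻ : ∀ {u v} → u ∙ v ≡ -1ℤ → Adj A u v
  adj⁻ eq eq′ with () ← trans (sym eq) eq′

  ⁺≢⁻ : ∀ {u v} → u ∙ v ≡ 1ℤ → u ∙ v ≡ -1ℤ → ⊥
  ⁺≢⁻ eq eq′ with () ← trans (sym eq) eq′

  adj-irrefl : ∀ {u v} → Adj A u v → u ≢ v
  adj-irrefl {inj₁ _} adj refl = adj refl
  adj-irrefl {inj₂ _} adj refl = adj refl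

  positives negatives : Vtx n → ℕ
  positives u = # (λ v → u ∙ v ℤ.≟ 1ℤ)
  negatives u = # (λ v → u ∙ v ℤ.≟ -1ℤ)

  adj? : ∀ u v → Dec (Adj A u v)
  adj? u v = ¬? (u ∙ v ℤ.≟ 0ℤ)

  line : Vtx n → List ℤ
  line (inj₁ i) = row A i
  line (inj₂ j) = col A j

  -- The vertices on the side of `u` itself carry sign 0, so they drop out because `h 0ℤ` vanishes.
  ∑-line : ∀ u (h : ℤ → ℕ) → h 0ℤ ≡ 0 → ∑ els (λ v → h (u ∙ v)) ≡ ∑ (line u) h
  ∑-line (inj₁ i) h h0 =
    trans (∑-vertices n (λ v → h (inj₁ i ∙ v)))
      (cong₂ _+_ (∑-zero (allFin n) (λ _ → h0)) (sym (∑-tabulate (λ j → A i j) h)))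
  ∑-line (inj₂ j) h h0 =
    trans (∑-vertices n (λ v → h (inj₂ j ∙ v)))
      (trans (cong₂ _+_ (sym (∑-tabulate (λ i → A i j) h)) (∑-zero (allFin n) (λ _ → h0)))
             (ℕ.+-identityʳ _))

  handshake : ∑ els (λ u → ∑ els (λ v → ind (adj? u v))) ≡ nnz A + nnz A
  handshake =
    trans (∑-cong els (λ u → ∑-line u nonzero refl))
    (trans (∑-vertices n (λ u → ∑ (line u) nonzero))
    (cong₂ _+_
      (trans (∑-cong (allFin n) (λ i → ∑-tabulate (λ j → A i j) nonzero)) (sym (nnz-∑ A)))
      (trans (∑-cong (allFin n) (λ j → ∑-tabulate (λ i → A i j) nonzero))
        (trans (∑-comm (allFin n) (allFin n) (λ j i → nonzero (A i j))) (sym (nnz-∑ A))))))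

  size : length els ≡ n + n
  size = trans (List.length-++ (map inj₁ (allFin n)))
    (cong₂ _+_ (trans (List.length-map inj₁ (allFin n)) (List.length-tabulate {n = n} id))
               (trans (List.length-map inj₂ (allFin n)) (List.length-tabulate {n = n} id)))

  Near : Vtx n → Vtx n → Vtx n → Set
  Near v a b = ix a < ix b × (∀ w → Adj A v w → ix a < ix w → ix w < ix b → ⊥)

  near? : ∀ v a b → Dec (Near v a b)
  near? v a b = (ix a ℕ.<? ix b) ×-dec
    allᵛ? (λ w → adj? v w →-dec ((ix a ℕ.<? ix w) →-dec ((ix w ℕ.<? ix b) →-dec no id)))

  -- As a line has one more +1 than it has -1's, a leaf has degree 1 and a hub degree 3.
  Leaf Hub Core : Vtx n → Set
  Leaf u = negatives u ≡ 0
  Hub u  = negatives u ≡ 1 × (∀ v → u ∙ v ≡ 1ℤ → Leaf v)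
  Core u = ¬ Leaf u × ¬ Hub u

  leaf? : ∀ u → Dec (Leaf u)
  leaf? u = negatives u ℕ.≟ 0

  hub? : ∀ u → Dec (Hub u)
  hub? u = (negatives u ℕ.≟ 1) ×-dec allᵛ? (λ v → (u ∙ v ℤ.≟ 1ℤ) →-dec leaf? v)

  core? : ∀ u → Dec (Core u)
  core? u = ¬? (leaf? u) ×-dec ¬? (hub? u)

  -- The copy of D₃ centred at the entry uv can then be detached, and the +1 of the line of v on the
  -- other side of u is the entry it was attached to.
  Detachable : Set
  Detachable = ∃ λ u → ∃ λ v → ∃ λ w → Hub u × u ∙ v ≡ -1ℤ × Leaf w × v ∙ w ≡ 1ℤ ×
               (Near v u w ⊎ Near v w u)

  abstract
    detachable? : Dec Detachable
    detachable? = anyᵛ? λ u → anyᵛ? λ v → anyᵛ? λ w →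
      hub? u ×-dec (u ∙ v ℤ.≟ -1ℤ) ×-dec leaf? w ×-dec (v ∙ w ℤ.≟ 1ℤ) ×-dec
      (near? v u w ⊎-dec near? v w u)

  module ASM (asm : IsASM A) where
    open IsASM asm

    abstract
      sign : ∀ u v → u ∙ v ≡ 0ℤ ⊎ u ∙ v ≡ 1ℤ ⊎ u ∙ v ≡ -1ℤ
      sign (inj₁ i) (inj₁ _) = inj₁ refl
      sign (inj₁ i) (inj₂ j) = entries i j
      sign (inj₂ j) (inj₁ i) = entries i j
      sign (inj₂ j) (inj₂ _) = inj₁ refl

      adj-sign : ∀ {u v} → Adj A u v → u ∙ v ≡ 1ℤ ⊎ u ∙ v ≡ -1ℤ
      adj-sign {u} {v} adj with sign u v
      ... | inj₁ eq = contradiction eq adj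
      ... | inj₂ s  = s

      line-alt : ∀ u → Alternating (nonzeros (line u))
      line-alt (inj₁ i) = rowsAlt i
      line-alt (inj₂ j) = colsAlt j

      balance : ∀ u → positives u ≡ suc (negatives u)
      balance u = trans (∑-line u _ refl) (trans (line-balance (line u) (line-alt u))
                    (cong suc (sym (∑-line u _ refl))))

      next⁺ : ∀ v {u} → v ∙ u ≡ -1ℤ → ∃ λ z → v ∙ z ≡ 1ℤ × Near v u z
      next⁺ (inj₁ i) {inj₂ j} eq with z , lt , p , gap ← next-positive (A i) (rowsAlt i) eq =
        inj₂ z , p , lt , λ { (inj₁ w) adj _ _ → adj refl ; (inj₂ w) adj l r → adj (gap w l r) }
      next⁺ (inj₂ j) {inj₁ i} eq with z , lt , p , gap ← next-positive (λ k → A k j) (colsAlt j) eq =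
        inj₁ z , p , lt , λ { (inj₂ w) adj _ _ → adj refl ; (inj₁ w) adj l r → adj (gap w l r) }

      prev⁺ : ∀ v {u} → v ∙ u ≡ -1ℤ → ∃ λ z → v ∙ z ≡ 1ℤ × Near v z u
      prev⁺ (inj₁ i) {inj₂ j} eq with z , lt , p , gap ← prev-positive (A i) (rowsAlt i) eq =
        inj₂ z , p , lt , λ { (inj₁ w) adj _ _ → adj refl ; (inj₂ w) adj l r → adj (gap w l r) }
      prev⁺ (inj₂ j) {inj₁ i} eq with z , lt , p , gap ← prev-positive (λ k → A k j) (colsAlt j) eq =
        inj₁ z , p , lt , λ { (inj₂ w) adj _ _ → adj refl ; (inj₁ w) adj l r → adj (gap w l r) }

      leaf-edge : ∀ {u v} → Leaf u → Adj A u v → u ∙ v ≡ 1ℤ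
      leaf-edge {u} {v} leaf adj with adj-sign {u} {v} adj
      ... | inj₁ p = p
      ... | inj₂ m = contradiction m (#-0⇒none (λ v → u ∙ v ℤ.≟ -1ℤ) leaf v)

      leaf-unique : ∀ {u v w} → Leaf u → Adj A u v → Adj A u w → v ≡ w
      leaf-unique {u} {v} {w} leaf p q =
        #-1⇒unique (λ v → u ∙ v ℤ.≟ 1ℤ) (trans (balance u) (cong suc leaf))
          (leaf-edge {u} {v} leaf p) (leaf-edge {u} {w} leaf q) (v ≟ᵛ w)

      positive-nbr : ∀ u → ∃ λ v → u ∙ v ≡ 1ℤ
      positive-nbr u = #-∃ (λ v → u ∙ v ℤ.≟ 1ℤ) (subst (1 ≤_) (sym (balance u)) (s≤s z≤n))

      hub-negative : ∀ {u} → Hub u → ∃ λ v → u ∙ v ≡ -1ℤ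
      hub-negative {u} (one , _) = #-∃ (λ v → u ∙ v ℤ.≟ -1ℤ) (subst (1 ≤_) (sym one) (s≤s z≤n))

      hub-unique : ∀ {u v w} → Hub u → u ∙ v ≡ -1ℤ → u ∙ w ≡ -1ℤ → v ≡ w
      hub-unique {u} {v} {w} (one , _) p q =
        #-1⇒unique (λ v → u ∙ v ℤ.≟ -1ℤ) one p q (v ≟ᵛ w)

      -- The far end of a positive edge at a hub is a leaf, so has no negative neighbour.
      hub-positive-nbr : ∀ {u v} → Hub u → u ∙ v ≡ 1ℤ → ¬ Hub v
      hub-positive-nbr {u} {v} (_ , leaves) p (one , _) with () ← trans (sym (leaves v p)) one

      ∙⁻-not-leaf : ∀ {u v} → u ∙ v ≡ -1ℤ → ¬ Leaf u
      ∙⁻-not-leaf {u} {v} m leaf = #-0⇒none (λ v → u ∙ v ℤ.≟ -1ℤ) leaf v m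

      leaf⊎hub⊎core : ∀ u → Leaf u ⊎ Hub u ⊎ Core u
      leaf⊎hub⊎core u with leaf? u | hub? u
      ... | yes l | _     = inj₁ l
      ... | no ¬l | yes h = inj₂ (inj₁ h)
      ... | no ¬l | no ¬h = inj₂ (inj₂ (¬l , ¬h))

      positive-enum : ∀ {u k} → negatives u ≡ k → Enum (suc k) (λ v → u ∙ v ≡ 1ℤ)
      positive-enum {u} eq = subst (λ k → Enum k (λ v → u ∙ v ≡ 1ℤ))
        (trans (balance u) (cong suc eq)) (#-enum (λ v → u ∙ v ℤ.≟ 1ℤ))

-- Nonzero entries of an attachment

∑-punchIn : ∀ {n} (g : Fin (suc n) → ℕ) a →
            ∑ (allFin (suc n)) g ≡ g a + ∑ (allFin n) (g ∘ punchIn a)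
∑-punchIn {n} g zero = cong (λ z → g zero + z) (∑-tabulate suc g)
∑-punchIn {suc n} g (suc a) =
  trans (cong (λ z → g zero + z) (trans (∑-tabulate suc g) (∑-punchIn (g ∘ suc) a)))
  (trans (x∙yz≈y∙xz (g zero) (g (suc a)) _)
    (cong (λ z → g (suc a) + (g zero + z)) (sym (∑-tabulate suc (g ∘ punchIn (suc a))))))
  where
  x∙yz≈y∙xz : ∀ x y z → x + (y + z) ≡ y + (x + z)
  x∙yz≈y∙xz = solve 3 (λ x y z → x :+ (y :+ z) := y :+ (x :+ z)) refl
    where open +-*-Solver

∑-single : ∀ {n} (g : Fin n → ℕ) a → (∀ i → i ≢ a → g i ≡ 0) → ∑ (allFin n) g ≡ g a
∑-single {suc n} g a zeros =
  trans (∑-punchIn g a) (trans (cong (λ z → g a + z)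
    (∑-zero (allFin n) (λ i → zeros (punchIn a i) (Fin.punchInᵢ≢i a i)))) (ℕ.+-identityʳ _))

-- An injection of a finite set into itself is a permutation. The induction deletes `zero` from the
-- domain and `e zero` from the codomain.
∑-injective : ∀ {n} (e : Fin n → Fin n) → (∀ {i j} → e i ≡ e j → i ≡ j) → (g : Fin n → ℕ) →
              ∑ (allFin n) g ≡ ∑ (allFin n) (g ∘ e)
∑-injective {zero}  e inj g = refl
∑-injective {suc n} e inj g =
  trans (∑-punchIn g (e zero)) (cong (λ z → g (e zero) + z)
    (trans (∑-injective e′ e′-inj (g ∘ punchIn (e zero)))
    (trans (∑-cong (allFin n) (λ i → cong g (Fin.punchIn-punchOut (apart i))))
           (sym (∑-tabulate suc (g ∘ e))))))
  where
  apart : ∀ i → e zero ≢ e (suc i)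
  apart i eq with () ← inj eq

  e′ : Fin n → Fin n
  e′ i = punchOut (apart i)

  e′-inj : ∀ {i j} → e′ i ≡ e′ j → i ≡ j
  e′-inj {i} {j} eq = Fin.suc-injective (inj (Fin.punchOut-injective (apart i) (apart j) eq))

strict⇒injective : ∀ {m k} {f : Fin m → Fin k} → StrictlyIncreasing f → ∀ {i j} → f i ≡ f j → i ≡ j
strict⇒injective {f = f} inc {i} {j} eq with ℕ.<-cmp (toℕ i) (toℕ j)
... | tri< lt _ _ = contradiction (cong toℕ eq) (ℕ.<⇒≢ (inc i j lt))
... | tri≈ _ e _  = Fin.toℕ-injective e
... | tri> _ _ gt = contradiction (cong toℕ (sym eq)) (ℕ.<⇒≢ (inc j i gt))

-- Prepending the two new indices to `σ` gives an injective self-map, hence a reindexing. The new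
-- rows or columns are thus split off without knowing where they were inserted.
∑-extend : ∀ {n} (σ : Fin n → Fin (suc (suc n))) → (∀ {i j} → σ i ≡ σ j → i ≡ j) →
           ∀ {a b} → a ≢ b → New σ a → New σ b → (g : Fin (suc (suc n)) → ℕ) →
           ∑ (allFin (suc (suc n))) g ≡ g a + (g b + ∑ (allFin n) (g ∘ σ))
∑-extend {n} σ inj {a} {b} a≢b a-new b-new g =
  trans (∑-injective e e-inj g) (cong (λ z → g a + (g b + z)) (∑-tabulate (λ i → suc (suc i)) (g ∘ e)))
  where
  e : Fin (suc (suc n)) → Fin (suc (suc n))
  e 0F            = a
  e 1F            = b
  e (suc (suc i)) = σ i

  e-inj : ∀ {i j} → e i ≡ e j → i ≡ j
  e-inj {0F}          {0F}          _  = refl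
  e-inj {0F}          {1F}          eq = contradiction eq a≢b
  e-inj {0F}          {suc (suc j)} eq = contradiction (sym eq) (a-new j)
  e-inj {1F}          {0F}          eq = contradiction (sym eq) a≢b
  e-inj {1F}          {1F}          _  = refl
  e-inj {1F}          {suc (suc j)} eq = contradiction (sym eq) (b-new j)
  e-inj {suc (suc i)} {0F}          eq = contradiction eq (a-new i)
  e-inj {suc (suc i)} {1F}          eq = contradiction eq (b-new i)
  e-inj {suc (suc i)} {suc (suc j)} eq = cong (λ k → suc (suc k)) (inj eq)

other₁ other₂ : Fin 3 → Fin 3
other₁ 0F = 1F
other₁ 1F = 0F
other₁ 2F = 0F
other₂ 0F = 2F
other₂ 1F = 2F
other₂ 2F = 1F

other₁≢ : ∀ p → other₁ p ≢ p
other₁≢ 0F ()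
other₁≢ 1F ()
other₁≢ 2F ()

other₂≢ : ∀ p → other₂ p ≢ p
other₂≢ 0F ()
other₂≢ 1F ()
other₂≢ 2F ()

other₁≢other₂ : ∀ p → other₁ p ≢ other₂ p
other₁≢other₂ 0F ()
other₁≢other₂ 1F ()
other₁≢other₂ 2F ()

-- `D₃` has five nonzero entries, one of which is the old +1 already counted in `s`. The bracketing
-- is the one left by splitting off the new rows and then, in each row, the new columns.
D₃-excess : ∀ p q → D₃ p q ≡ 1ℤ → let d = λ r c → nonzero (D₃ r c) in ∀ s →
  (d (other₁ p) (other₁ q) + (d (other₁ p) (other₂ q) + d (other₁ p) q)) +
  ((d (other₂ p) (other₁ q) + (d (other₂ p) (other₂ q) + d (other₂ p) q)) +
  (d p (other₁ q) + (d p (other₂ q) + s))) ≡ 4 + s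
D₃-excess 0F 1F _ s = refl
D₃-excess 1F 0F _ s = refl
D₃-excess 1F 2F _ s = refl
D₃-excess 2F 1F _ s = refl

attach-nnz : ∀ {n} {A : Matrix n} {B : Matrix (suc (suc n))} → AttachD₃ A B → nnz B ≡ 4 + nnz A
attach-nnz {n} {A} {B} att =
  trans (nnz-∑ B)
  (trans (∑-extend σ σ-inj (ρ-apart p) (ρ-new _ (other₁≢ p)) (ρ-new _ (other₂≢ p)) rowSum)
  (trans (cong₂ _+_ (newRow (other₁ p) (other₁≢ p))
            (cong₂ _+_ (newRow (other₂ p) (other₂≢ p)) oldRows))
  (D₃-excess p q Dpq (nnz A))))
  where
  open AttachD₃ att

  σ-inj : ∀ {i j} → σ i ≡ σ j → i ≡ j
  σ-inj = strict⇒injective {f = σ} σ-inc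

  τ-inj : ∀ {i j} → τ i ≡ τ j → i ≡ j
  τ-inj = strict⇒injective {f = τ} τ-inc

  ρ-apart : ∀ p → ρ (other₁ p) ≢ ρ (other₂ p)
  ρ-apart p eq = other₁≢other₂ p (strict⇒injective {f = ρ} ρ-inc eq)

  γ-apart : ∀ q → γ (other₁ q) ≢ γ (other₂ q)
  γ-apart q eq = other₁≢other₂ q (strict⇒injective {f = γ} γ-inc eq)

  b : Fin (suc (suc n)) → Fin (suc (suc n)) → ℕ
  b r c = nonzero (B r c)

  rowSum : Fin (suc (suc n)) → ℕ
  rowSum r = ∑ (allFin _) (b r)

  splitRow : ∀ r → rowSum r ≡
             b r (γ (other₁ q)) + (b r (γ (other₂ q)) + ∑ (allFin n) (λ j → b r (τ j)))
  splitRow r = ∑-extend τ τ-inj (γ-apart q) (γ-new _ (other₁≢ q)) (γ-new _ (other₂≢ q)) (b r)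

  d : Fin 3 → Fin 3 → ℕ
  d r c = nonzero (D₃ r c)

  b-sub : ∀ p′ q′ → b (ρ p′) (γ q′) ≡ d p′ q′
  b-sub p′ q′ = cong nonzero (sub p′ q′)

  off-γ : ∀ j′ → j′ ≢ j → ∀ q′ → γ q′ ≢ τ j′
  off-γ j′ j′≢j q′ eq with q′ Fin.≟ q
  ... | yes refl = j′≢j (τ-inj (trans (sym eq) γq))
  ... | no q′≢q  = γ-new q′ q′≢q j′ (sym eq)

  off-ρ : ∀ i′ → i′ ≢ i → ∀ p′ → ρ p′ ≢ σ i′
  off-ρ i′ i′≢i p′ eq with p′ Fin.≟ p
  ... | yes refl = i′≢i (σ-inj (trans (sym eq) ρp))
  ... | no p′≢p  = ρ-new p′ p′≢p i′ (sym eq)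

  newRow : ∀ p′ → p′ ≢ p → rowSum (ρ p′) ≡ d p′ (other₁ q) + (d p′ (other₂ q) + d p′ q)
  newRow p′ p′≢p = trans (splitRow (ρ p′)) (cong₂ _+_ (b-sub p′ _) (cong₂ _+_ (b-sub p′ _)
    (trans (∑-single (λ j′ → b (ρ p′) (τ j′)) j
             (λ j′ j′≢j → cong nonzero (zeros _ _ (inj₁ (ρ-new p′ p′≢p)) (inj₂ (off-γ j′ j′≢j)))))
      (trans (cong (b (ρ p′)) (sym γq)) (b-sub p′ q)))))

  newCol : ∀ q′ → q′ ≢ q → ∑ (allFin n) (λ i′ → b (σ i′) (γ q′)) ≡ d p q′
  newCol q′ q′≢q =
    trans (∑-single (λ i′ → b (σ i′) (γ q′)) i
             (λ i′ i′≢i → cong nonzero (zeros _ _ (inj₂ (γ-new q′ q′≢q)) (inj₁ (off-ρ i′ i′≢i)))))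
      (trans (cong (λ r → b r (γ q′)) (sym ρp)) (b-sub p q′))

  oldRows : ∑ (allFin n) (rowSum ∘ σ) ≡ d p (other₁ q) + (d p (other₂ q) + nnz A)
  oldRows =
    trans (∑-cong (allFin n) (splitRow ∘ σ))
    (trans (∑-+ (allFin n) (λ i′ → b (σ i′) (γ (other₁ q))) _)
    (cong₂ _+_ (newCol _ (other₁≢ q))
      (trans (∑-+ (allFin n) (λ i′ → b (σ i′) (γ (other₂ q))) _)
      (cong₂ _+_ (newCol _ (other₂≢ q))
        (trans (∑-cong (allFin n) (λ i′ → ∑-cong (allFin n) (λ j′ → cong nonzero (old i′ j′))))
               (sym (nnz-∑ A)))))))

nnz-cong : ∀ {n} {A B : Matrix n} → (∀ i j → B i j ≡ A i j) → nnz B ≡ nnz A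
nnz-cong {n} {A} {B} eq = trans (nnz-∑ B) (trans
  (∑-cong (allFin n) (λ i → ∑-cong (allFin n) (λ j → cong nonzero (eq i j)))) (sym (nnz-∑ A)))

-- The invariance of nnz - 2n, written crosswise because subtraction on `ℕ` truncates.
attachSeq-nnz : ∀ {m n} {A : Matrix m} {B : Matrix n} → AttachSeq A n B →
                nnz B + 2 * m ≡ nnz A + 2 * n
attachSeq-nnz {m} (base eq) = cong (λ z → z + 2 * m) (nnz-cong eq)
attachSeq-nnz {m} {A = A} (step {n} {B} {C} seq att) = begin
  nnz C + 2 * m        ≡⟨ cong (λ z → z + 2 * m) (attach-nnz att) ⟩
  4 + (nnz B + 2 * m)  ≡⟨ cong (λ z → 4 + z) (attachSeq-nnz seq) ⟩
  4 + (nnz A + 2 * n)  ≡⟨ solve 2 (λ a n → con 4 :+ (a :+ con 2 :* n) :=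
                            a :+ con 2 :* (con 2 :+ n)) refl (nnz A) n ⟩
  nnz A + 2 * (2 + n)  ∎
  where
  open ≡-Reasoning
  open +-*-Solver

-- Detaching D₃

skip-injective : ∀ {n} {a b : Fin (suc (suc n))} (a≢b : a ≢ b) {i j} →
                 skip a≢b i ≡ skip a≢b j → i ≡ j
skip-injective a≢b eq =
  Fin.punchIn-injective (punchOut a≢b) _ _ (Fin.punchIn-injective _ _ _ eq)

skip-increasing : ∀ {n} {a b : Fin (suc (suc n))} (a≢b : a ≢ b) → StrictlyIncreasing (skip a≢b)
skip-increasing {a = a} a≢b i j i<j = ℕ.≤∧≢⇒<
  (Fin.punchIn-mono-≤ a _ _ (Fin.punchIn-mono-≤ (punchOut a≢b) i j (ℕ.<⇒≤ i<j)))
  (λ eq → ℕ.<⇒≢ i<j (cong toℕ (skip-injective a≢b (Fin.toℕ-injective eq))))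

skip≢₁ : ∀ {n} {a b : Fin (suc (suc n))} (a≢b : a ≢ b) i → skip a≢b i ≢ a
skip≢₁ {a = a} a≢b i = Fin.punchInᵢ≢i a _

skip≢₂ : ∀ {n} {a b : Fin (suc (suc n))} (a≢b : a ≢ b) i → skip a≢b i ≢ b
skip≢₂ {a = a} a≢b i eq = Fin.punchInᵢ≢i (punchOut a≢b) i
  (Fin.punchIn-injective a _ _ (trans eq (sym (Fin.punchIn-punchOut a≢b))))

skip-onto : ∀ {n} {a b : Fin (suc (suc n))} (a≢b : a ≢ b) x → x ≢ a → x ≢ b →
            ∃ λ i → skip a≢b i ≡ x
skip-onto {a = a} a≢b x x≢a x≢b = punchOut b′≢x′ ,
  trans (cong (punchIn a) (Fin.punchIn-punchOut b′≢x′)) (Fin.punchIn-punchOut (x≢a ∘ sym))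
  where
  b′≢x′ : punchOut a≢b ≢ punchOut (x≢a ∘ sym)
  b′≢x′ eq = x≢b (sym (Fin.punchOut-injective a≢b (x≢a ∘ sym) eq))

skip-new : ∀ {n} {a b : Fin (suc (suc n))} (a≢b : a ≢ b) {x} → New (skip a≢b) x → x ≡ a ⊎ x ≡ b
skip-new {a = a} {b} a≢b {x} new with x Fin.≟ a | x Fin.≟ b
... | yes e | _     = inj₁ e
... | no _  | yes e = inj₂ e
... | no x≢a | no x≢b with i , eq ← skip-onto a≢b x x≢a x≢b = contradiction eq (new i)

-- The side of the centre row of D₃ on which lies the outer row that is removed along with it.
data Side : Set where
  above below : Side

-- `lower` and `upper` are the two rows of `D₃` that disappear, the centre and the removed outer
-- one, in increasing order.
removed kept lower upper : Side → Fin 3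
removed above = 0F
removed below = 2F
kept above    = 2F
kept below    = 0F
lower above   = 0F
lower below   = 1F
upper above   = 1F
upper below   = 2F

lower<upper : ∀ s → lower s <ᶠ upper s
lower<upper above = s≤s z≤n
lower<upper below = s≤s (s≤s z≤n)

-- A removable `D₃` whose hub is the row `ρ 1F`. The outer columns are leaves of the hub, row
-- `ρ (removed s)` is a leaf of the middle column, and the +1 in row `ρ (kept s)` is what remains.
-- `gap` makes the two entries lost by the middle column consecutive.
record Site {n} (A : Matrix n) : Set where
  field
    ρ γ      : Fin 3 → Fin n
    ρ-inc    : StrictlyIncreasing ρ
    γ-inc    : StrictlyIncreasing γ
    sub      : ∀ p q → A (ρ p) (γ q) ≡ D₃ p q
    s        : Side
    centre   : ∀ y → (∀ q → γ q ≢ y) → A (ρ 1F) y ≡ 0ℤ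
    row-leaf : ∀ y → y ≢ γ 1F → A (ρ (removed s)) y ≡ 0ℤ
    col-leaf : ∀ x q → q ≢ 1F → x ≢ ρ 1F → A x (γ q) ≡ 0ℤ
    gap      : Gap (λ x → A x (γ 1F)) (ρ (lower s)) (ρ (upper s))

increasing-injective : ∀ {n} {f : Fin 3 → Fin n} → StrictlyIncreasing f →
                       ∀ {i j} → i ≢ j → f i ≢ f j
increasing-injective {f = f} inc i≢j eq = i≢j (strict⇒injective {f = f} inc eq)

module Detach {n} (A : Matrix (suc (suc n))) (asm : IsASM A) (site : Site A) where
  open Site site
  open IsASM asm

  ρ≢ : ∀ {i j} → i ≢ j → ρ i ≢ ρ j
  ρ≢ = increasing-injective ρ-inc

  γ≢ : ∀ {i j} → i ≢ j → γ i ≢ γ j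
  γ≢ = increasing-injective γ-inc

  lower≢upper : ρ (lower s) ≢ ρ (upper s)
  lower≢upper = ρ≢ (λ eq → ℕ.<⇒≢ (lower<upper s) (cong toℕ eq))

  left≢right : γ 0F ≢ γ 2F
  left≢right = γ≢ λ ()

  σ τ : Fin n → Fin (suc (suc n))
  σ = skip lower≢upper
  τ = skip left≢right

  σ≢centre : ∀ i → σ i ≢ ρ 1F
  σ≢centre i with s | skip≢₁ lower≢upper i | skip≢₂ lower≢upper i
  ... | above | _ | ne = ne
  ... | below | ne | _ = ne

  σ≢leaf : ∀ i → σ i ≢ ρ (removed s)
  σ≢leaf i with s | skip≢₁ lower≢upper i | skip≢₂ lower≢upper i
  ... | above | ne | _ = ne
  ... | below | _ | ne = ne

  σ-onto : ∀ x → x ≢ ρ 1F → x ≢ ρ (removed s) → ∃ λ i → σ i ≡ x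
  σ-onto x ne₁ ne₂ = skip-onto lower≢upper x (proj₁ both) (proj₂ both)
    where
    both : x ≢ ρ (lower s) × x ≢ ρ (upper s)
    both with s
    ... | above = ne₂ , ne₁
    ... | below = ne₁ , ne₂

  σ-new : ∀ {x} → New σ x → x ≡ ρ 1F ⊎ x ≡ ρ (removed s)
  σ-new {x} new with x Fin.≟ ρ 1F | x Fin.≟ ρ (removed s)
  ... | yes e | _     = inj₁ e
  ... | no _  | yes e = inj₂ e
  ... | no x≢c | no x≢l with i , eq ← σ-onto x x≢c x≢l = contradiction eq (new i)

  kept-row : ∃ λ i → σ i ≡ ρ (kept s)
  kept-row = σ-onto (ρ (kept s)) (ρ≢ (kept≢1 s)) (ρ≢ (kept≢removed s))
    where
    kept≢1 : ∀ s → kept s ≢ 1F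
    kept≢1 above ()
    kept≢1 below ()
    kept≢removed : ∀ s → kept s ≢ removed s
    kept≢removed above ()
    kept≢removed below ()

  kept-col : ∃ λ j → τ j ≡ γ 1F
  kept-col = skip-onto left≢right (γ 1F) (γ≢ λ ()) (γ≢ λ ())

  reduced : Matrix n
  reduced i j = A (σ i) (τ j)

  off-γ : ∀ j → τ j ≢ γ 1F → ∀ q → γ q ≢ τ j
  off-γ j ne 0F eq = skip≢₁ left≢right j (sym eq)
  off-γ j ne 1F eq = ne (sym eq)
  off-γ j ne 2F eq = skip≢₂ left≢right j (sym eq)

  centre-or-leaf : ∀ {P : Fin 3 → Set} → P 1F → P (removed s) → P (lower s) × P (upper s)
  centre-or-leaf c l with s
  ... | above = l , c
  ... | below = c , l

  reduced-asm : IsASM reduced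
  reduced-asm = record
    { entries = λ i j → entries (σ i) (τ j)
    ; rowsAlt = λ i → subst Alternating
        (sym (nz-skip-zeros (A (σ i)) left≢right (col-leaf _ 0F (λ ()) (σ≢centre i))
                                                 (col-leaf _ 2F (λ ()) (σ≢centre i))))
        (rowsAlt (σ i))
    ; colsAlt = colsAlt′
    }
    where
    colsAlt′ : ∀ j → Alternating (nz (λ i → reduced i j))
    colsAlt′ j with τ j Fin.≟ γ 1F
    ... | no ne = subst Alternating (sym (nz-skip-zeros (λ x → A x (τ j)) lower≢upper (proj₁ zeros) (proj₂ zeros)))
                    (colsAlt (τ j))
      where
      zeros : A (ρ (lower s)) (τ j) ≡ 0ℤ × A (ρ (upper s)) (τ j) ≡ 0ℤ
      zeros = centre-or-leaf {λ p → A (ρ p) (τ j) ≡ 0ℤ} (centre _ (off-γ j ne)) (row-leaf _ ne)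
    -- The middle column is the one surviving column that loses nonzero entries: a consecutive +1,
    -- -1 if the leaf row lies above the centre, a consecutive -1, +1 if it lies below.
    ... | yes eq rewrite eq with s | lower≢upper | lower<upper s | gap
    ...   | above | l≢u | l<u | g = cut⁺⁻-alt cut (colsAlt (γ 1F))
      where
      f = λ x → A x (γ 1F)
      cut : Cut 1ℤ -1ℤ (nz f) (nz (f ∘ skip l≢u))
      cut = subst₂ (λ a b → Cut a b (nz f) (nz (f ∘ skip l≢u))) (sub 0F 1F) (sub 1F 1F)
              (cut-skip f l≢u (ρ-inc _ _ l<u) (λ e → case trans (sym (sub 0F 1F)) e of λ ())
                (λ e → case trans (sym (sub 1F 1F)) e of λ ()) g)
    ...   | below | l≢u | l<u | g = cut⁻⁺-alt cut (colsAlt (γ 1F))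
      where
      f = λ x → A x (γ 1F)
      cut : Cut -1ℤ 1ℤ (nz f) (nz (f ∘ skip l≢u))
      cut = subst₂ (λ a b → Cut a b (nz f) (nz (f ∘ skip l≢u))) (sub 1F 1F) (sub 2F 1F)
              (cut-skip f l≢u (ρ-inc _ _ l<u) (λ e → case trans (sym (sub 1F 1F)) e of λ ())
                (λ e → case trans (sym (sub 2F 1F)) e of λ ()) g)

  p≢kept : ∀ {p} → p ≢ kept s → p ≡ 1F ⊎ p ≡ removed s
  p≢kept {p} ne with s | p
  ... | above | 0F = inj₂ refl
  ... | above | 1F = inj₁ refl
  ... | above | 2F = contradiction refl ne
  ... | below | 0F = contradiction refl ne
  ... | below | 1F = inj₁ refl
  ... | below | 2F = inj₂ refl

  D₃-kept : D₃ (kept s) 1F ≡ 1ℤ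
  D₃-kept with s
  ... | above = refl
  ... | below = refl

  attach : AttachD₃ reduced A
  attach = record
    { isASM = asm
    ; σ = σ ; τ = τ
    ; σ-inc = skip-increasing lower≢upper
    ; τ-inc = skip-increasing left≢right
    ; old   = λ _ _ → refl
    ; i = proj₁ kept-row ; j = proj₁ kept-col
    ; aij = trans (cong₂ A (proj₂ kept-row) (proj₂ kept-col)) (trans (sub (kept s) 1F) D₃-kept)
    ; ρ = ρ ; γ = γ ; ρ-inc = ρ-inc ; γ-inc = γ-inc ; sub = sub
    ; p = kept s ; q = 1F
    ; Dpq = D₃-kept
    ; ρp = sym (proj₂ kept-row)
    ; γq = sym (proj₂ kept-col)
    ; ρ-new = λ p′ ne i eq → [ (λ { refl → σ≢centre i eq }) , (λ { refl → σ≢leaf i eq }) ]′ (p≢kept ne)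
    ; γ-new = λ { 0F _ → skip≢₁ left≢right ; 1F ne → contradiction refl ne ; 2F _ → skip≢₂ left≢right }
    ; zeros = zeros
    }
    where
    zeros : ∀ x y → New σ x ⊎ New τ y → (∀ p → ρ p ≢ x) ⊎ (∀ q → γ q ≢ y) → A x y ≡ 0ℤ
    zeros x y (inj₁ new) off with σ-new new | off
    ... | inj₁ refl | inj₁ offρ = contradiction refl (offρ 1F)
    ... | inj₂ refl | inj₁ offρ = contradiction refl (offρ (removed s))
    ... | inj₁ refl | inj₂ offγ = centre y offγ
    ... | inj₂ refl | inj₂ offγ = row-leaf y (λ eq → offγ 1F (sym eq))
    zeros x y (inj₂ new) off with skip-new left≢right new | off
    ... | inj₁ refl | inj₁ offρ = col-leaf x 0F (λ ()) (λ eq → offρ 1F (sym eq))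
    ... | inj₂ refl | inj₁ offρ = col-leaf x 2F (λ ()) (λ eq → offρ 1F (sym eq))
    ... | inj₁ refl | inj₂ offγ = contradiction refl (offγ 0F)
    ... | inj₂ refl | inj₂ offγ = contradiction refl (offγ 2F)

  lift : Vtx n → Vtx (suc (suc n))
  lift (inj₁ i) = inj₁ (σ i)
  lift (inj₂ j) = inj₂ (τ j)

  lift-injective : ∀ {u v} → lift u ≡ lift v → u ≡ v
  lift-injective {inj₁ _} {inj₁ _} eq = cong inj₁ (skip-injective lower≢upper (Sum⊎.inj₁-injective eq))
  lift-injective {inj₂ _} {inj₂ _} eq = cong inj₂ (skip-injective left≢right (Sum⊎.inj₂-injective eq))

  BG-lift : ∀ u v → BG A (lift u) (lift v) ≡ BG reduced u v
  BG-lift (inj₁ _) (inj₁ _) = refl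
  BG-lift (inj₁ _) (inj₂ _) = refl
  BG-lift (inj₂ _) (inj₁ _) = refl
  BG-lift (inj₂ _) (inj₂ _) = refl

  data Gone : Vtx (suc (suc n)) → Set where
    centre-row : Gone (inj₁ (ρ 1F))
    leaf-row   : Gone (inj₁ (ρ (removed s)))
    left-col   : Gone (inj₂ (γ 0F))
    right-col  : Gone (inj₂ (γ 2F))

  gone-or-lift : ∀ x → Gone x ⊎ ∃ λ u → lift u ≡ x
  gone-or-lift (inj₁ x) with x Fin.≟ ρ 1F | x Fin.≟ ρ (removed s)
  ... | yes refl | _        = inj₁ centre-row
  ... | no _     | yes refl = inj₁ leaf-row
  ... | no ne    | no ne′ with i , refl ← σ-onto x ne ne′ = inj₂ (inj₁ i , refl)
  gone-or-lift (inj₂ y) with y Fin.≟ γ 0F | y Fin.≟ γ 2F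
  ... | yes refl | _        = inj₁ left-col
  ... | no _     | yes refl = inj₁ right-col
  ... | no ne    | no ne′ with j , refl ← skip-onto left≢right y ne ne′ = inj₂ (inj₂ j , refl)

  lift-not-gone : ∀ u → ¬ Gone (lift u)
  lift-not-gone (inj₁ i) g with σ i | σ≢centre i | σ≢leaf i
  lift-not-gone (inj₁ i) centre-row | _ | ne | _ = ne refl
  lift-not-gone (inj₁ i) leaf-row   | _ | _ | ne = ne refl
  lift-not-gone (inj₂ j) g with τ j | skip≢₁ left≢right j | skip≢₂ left≢right j
  lift-not-gone (inj₂ j) left-col  | _ | ne | _ = ne refl
  lift-not-gone (inj₂ j) right-col | _ | _ | ne = ne refl

  hinge : Vtx n
  hinge = inj₂ (proj₁ kept-col)

  -- The outer columns meet no row but the centre, and both removed rows meet the surviving columns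
  -- in the middle one only. So all contact with the rest passes through one vertex, and removal
  -- cannot disconnect.
  gone-nbr : ∀ {x u} → Gone x → Adj A x (lift u) → u ≡ hinge
  gone-nbr {u = inj₁ _} centre-row adj = contradiction refl adj
  gone-nbr {u = inj₁ _} leaf-row   adj = contradiction refl adj
  gone-nbr {u = inj₂ _} left-col   adj = contradiction refl adj
  gone-nbr {u = inj₂ _} right-col  adj = contradiction refl adj
  gone-nbr {u = inj₁ i} left-col   adj = contradiction (col-leaf _ 0F (λ ()) (σ≢centre i)) adj
  gone-nbr {u = inj₁ i} right-col  adj = contradiction (col-leaf _ 2F (λ ()) (σ≢centre i)) adj
  gone-nbr {u = inj₂ j} centre-row adj with τ j Fin.≟ γ 1F
  ... | yes eq = lift-injective (cong inj₂ (trans eq (sym (proj₂ kept-col))))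
  ... | no ne  = contradiction (centre _ (off-γ j ne)) adj
  gone-nbr {u = inj₂ j} leaf-row adj with τ j Fin.≟ γ 1F
  ... | yes eq = lift-injective (cong inj₂ (trans eq (sym (proj₂ kept-col))))
  ... | no ne  = contradiction (row-leaf _ ne) adj

  -- Contracting the four removed vertices into the hinge maps BG A onto BG reduced.
  Contracts : Vtx (suc (suc n)) → Vtx n → Set
  Contracts x u = lift u ≡ x ⊎ (Gone x × u ≡ hinge)

  contract-edge : ∀ {x y u} → Adj A x y → Contracts x u →
                  ∃ λ v → Contracts y v × Star (Adj reduced) u v
  contract-edge {x} {y} {u} adj (inj₁ refl) with gone-or-lift y
  ... | inj₂ (v , refl) = v , inj₁ refl , (λ eq → adj (trans (BG-lift u v) eq)) ◅ ε
  ... | inj₁ g with refl ← gone-nbr g (Graph.adj-sym A {lift u} {y} adj) =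
        hinge , inj₂ (g , refl) , ε
  contract-edge {x} {y} adj (inj₂ (g , refl)) with gone-or-lift y
  ... | inj₁ g′ = hinge , inj₂ (g′ , refl) , ε
  ... | inj₂ (v , refl) with refl ← gone-nbr {u = v} g adj = hinge , inj₁ refl , ε

  contract-path : ∀ {x y u} → Star (Adj A) x y → Contracts x u →
                  ∃ λ v → Contracts y v × Star (Adj reduced) u v
  contract-path ε c = _ , c , ε
  contract-path (adj ◅ path) c with v , c′ , p ← contract-edge adj c
                               with w , c″ , p′ ← contract-path path c′ = w , c″ , p ◅◅ p′

  reduced-connected : Connected A → Connected reduced
  reduced-connected conn u v with contract-path (conn (lift u) (lift v)) (inj₁ refl)
  ... | w , inj₁ eq , p with refl ← lift-injective eq = p
  ... | w , inj₂ (g , _) , _ = contradiction g (lift-not-gone v)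

-- Interchange of rows and columns

transpose : ∀ {n} → Matrix n → Matrix n
transpose A i j = A j i

transpose-asm : ∀ {n} {A : Matrix n} → IsASM A → IsASM (transpose A)
transpose-asm asm = record
  { entries = λ i j → entries j i ; rowsAlt = colsAlt ; colsAlt = rowsAlt }
  where open IsASM asm

BG-transpose : ∀ {n} (A : Matrix n) u v → BG (transpose A) (swap u) (swap v) ≡ BG A u v
BG-transpose A (inj₁ _) (inj₁ _) = refl
BG-transpose A (inj₁ _) (inj₂ _) = refl
BG-transpose A (inj₂ _) (inj₁ _) = refl
BG-transpose A (inj₂ _) (inj₂ _) = refl

swap-swap : ∀ {n} (u : Vtx n) → swap (swap u) ≡ u
swap-swap (inj₁ _) = refl
swap-swap (inj₂ _) = refl

ix-swap : ∀ {n} (u : Vtx n) → ix (swap u) ≡ ix u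
ix-swap (inj₁ _) = refl
ix-swap (inj₂ _) = refl

transpose-connected : ∀ {n} {A : Matrix n} → Connected A → Connected (transpose A)
transpose-connected {A = A} conn u v = subst₂ (Star (Adj (transpose A))) (swap-swap u) (swap-swap v)
  (gmap swap (λ {x} {y} adj eq → adj (trans (sym (BG-transpose A x y)) eq)) (conn (swap u) (swap v)))

D₃-symmetric : ∀ p q → D₃ p q ≡ D₃ q p
D₃-symmetric 0F 0F = refl
D₃-symmetric 0F 1F = refl
D₃-symmetric 0F 2F = refl
D₃-symmetric 1F 0F = refl
D₃-symmetric 1F 1F = refl
D₃-symmetric 1F 2F = refl
D₃-symmetric 2F 0F = refl
D₃-symmetric 2F 1F = refl
D₃-symmetric 2F 2F = refl

transpose-attach : ∀ {n} {A : Matrix n} {B : Matrix (suc (suc n))} →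
                   AttachD₃ A B → AttachD₃ (transpose A) (transpose B)
transpose-attach att = record
  { isASM = transpose-asm isASM
  ; σ = τ ; τ = σ ; σ-inc = τ-inc ; τ-inc = σ-inc
  ; old = λ i j → old j i
  ; i = j ; j = i ; aij = aij
  ; ρ = γ ; γ = ρ ; ρ-inc = γ-inc ; γ-inc = ρ-inc
  ; sub = λ p q → trans (sub q p) (D₃-symmetric q p)
  ; p = q ; q = p ; Dpq = trans (D₃-symmetric q p) Dpq
  ; ρp = γq ; γq = ρp ; ρ-new = γ-new ; γ-new = ρ-new
  ; zeros = λ r c new off → zeros c r (swap new) (swap off)
  }
  where open AttachD₃ att

-- The configuration of `Site` in the language of the graph, hence invariant under transposition;
-- this reduces a hub that is a column to one that is a row. `a` and `b` are the leaves of the hub,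
-- `w` the removed leaf of `v`, and `w′` the +1 on the other side of `u`, which stays.
record HubSite {n} (A : Matrix n) : Set where
  open Graph A using (_∙_; Near)
  field
    u v a b w w′ : Vtx n
    uv     : u ∙ v ≡ -1ℤ
    ua     : u ∙ a ≡ 1ℤ
    ub     : u ∙ b ≡ 1ℤ
    vw     : v ∙ w ≡ 1ℤ
    vw′    : v ∙ w′ ≡ 1ℤ
    a<v    : ix a < ix v
    v<b    : ix v < ix b
    u-nbrs : ∀ x → Adj A u x → x ≡ a ⊎ x ≡ v ⊎ x ≡ b
    a-leaf : ∀ x → Adj A a x → x ≡ u
    b-leaf : ∀ x → Adj A b x → x ≡ u
    w-leaf : ∀ x → Adj A w x → x ≡ v
    order  : (Near v w u × ix u < ix w′) ⊎ (Near v u w × ix w′ < ix u)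

transpose-hub : ∀ {n} {A : Matrix n} → HubSite A → HubSite (transpose A)
transpose-hub {A = A} H = record
  { u = swap u ; v = swap v ; a = swap a ; b = swap b ; w = swap w ; w′ = swap w′
  ; uv = edge u v uv ; ua = edge u a ua ; ub = edge u b ub
  ; vw = edge v w vw ; vw′ = edge v w′ vw′
  ; a<v = less a v a<v ; v<b = less v b v<b
  ; u-nbrs = λ x adj → case u-nbrs (swap x) (adj′ u x adj) of λ
      { (inj₁ e) → inj₁ (unswap e) ; (inj₂ (inj₁ e)) → inj₂ (inj₁ (unswap e))
      ; (inj₂ (inj₂ e)) → inj₂ (inj₂ (unswap e)) }
  ; a-leaf = λ x adj → unswap (a-leaf (swap x) (adj′ a x adj))
  ; b-leaf = λ x adj → unswap (b-leaf (swap x) (adj′ b x adj))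
  ; w-leaf = λ x adj → unswap (w-leaf (swap x) (adj′ w x adj))
  ; order = case order of λ
      { (inj₁ (near , lt)) → inj₁ (near′ v w u near , less u w′ lt)
      ; (inj₂ (near , lt)) → inj₂ (near′ v u w near , less w′ u lt) }
  }
  where
  open HubSite H
  Aᵀ = transpose A

  edge : ∀ x y {z} → BG A x y ≡ z → BG Aᵀ (swap x) (swap y) ≡ z
  edge x y eq = trans (BG-transpose A x y) eq

  less : ∀ x y → ix x < ix y → ix (swap x) < ix (swap y)
  less x y = subst₂ _<_ (sym (ix-swap x)) (sym (ix-swap y))

  adj′ : ∀ x y → Adj Aᵀ (swap x) y → Adj A x (swap y)
  adj′ x y adj eq =
    adj (trans (cong (BG Aᵀ (swap x)) (sym (swap-swap y))) (trans (BG-transpose A x (swap y)) eq))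

  unswap : ∀ {x y : Vtx _} → swap x ≡ y → x ≡ swap y
  unswap {x} eq = trans (sym (swap-swap x)) (cong swap eq)

  near′ : ∀ x y z → Graph.Near A x y z → Graph.Near Aᵀ (swap x) (swap y) (swap z)
  near′ x y z (lt , gap) = less y z lt , λ t adj l r → gap (swap t) (adj′ x t adj)
    (subst₂ _<_ (ix-swap y) (sym (ix-swap t)) l) (subst₂ _<_ (sym (ix-swap t)) (ix-swap z) r)

triple : ∀ {X : Set} → X → X → X → Fin 3 → X
triple x y z 0F = x
triple x y z 1F = y
triple x y z 2F = z

triple-increasing : ∀ {n} {x y z : Fin n} → x <ᶠ y → y <ᶠ z → StrictlyIncreasing (triple x y z)
triple-increasing x<y y<z 0F 1F _ = x<y
triple-increasing x<y y<z 0F 2F _ = ℕ.<-trans x<y y<z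
triple-increasing x<y y<z 1F 2F _ = y<z
triple-increasing x<y y<z 1F 1F (s≤s ())
triple-increasing x<y y<z 2F 1F (s≤s ())
triple-increasing x<y y<z 2F 2F (s≤s (s≤s ()))

zero-unless : ∀ {x} → ¬ (x ≢ 0ℤ) → x ≡ 0ℤ
zero-unless {x} = decidable-stable (x ℤ.≟ 0ℤ)

-- A nonzero sign joins opposite sides, so with `u` a row the vertices `v`, `a`, `b` are columns and
-- `w`, `w′` rows; the other patterns are refuted by the sign equations.
row-site : ∀ {n} {A : Matrix n} (H : HubSite A) {r} → HubSite.u H ≡ inj₁ r → Site A
row-site {A = A} record
  { u = .(inj₁ r) ; v = inj₂ c ; a = inj₂ c₁ ; b = inj₂ c₂ ; w = inj₁ x ; w′ = inj₁ x′
  ; uv = uv ; ua = ua ; ub = ub ; vw = vw ; vw′ = vw′ ; a<v = a<v ; v<b = v<b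
  ; u-nbrs = u-nbrs ; a-leaf = a-leaf ; b-leaf = b-leaf ; w-leaf = w-leaf ; order = order }
  {r} refl = site order
  where
  γ = triple c₁ c c₂

  col-leaf : ∀ y q → q ≢ 1F → y ≢ r → A y (γ q) ≡ 0ℤ
  col-leaf y 0F _  ne = zero-unless λ adj → ne (Sum⊎.inj₁-injective (a-leaf (inj₁ y) adj))
  col-leaf y 1F ne _  = contradiction refl ne
  col-leaf y 2F _  ne = zero-unless λ adj → ne (Sum⊎.inj₁-injective (b-leaf (inj₁ y) adj))

  centre : ∀ y → (∀ q → γ q ≢ y) → A r y ≡ 0ℤ
  centre y off = zero-unless λ adj → case u-nbrs (inj₂ y) adj of λ
    { (inj₁ refl) → off 0F refl ; (inj₂ (inj₁ refl)) → off 1F refl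
    ; (inj₂ (inj₂ refl)) → off 2F refl }

  row-leaf : ∀ y → y ≢ c → A x y ≡ 0ℤ
  row-leaf y ne = zero-unless λ adj → ne (Sum⊎.inj₂-injective (w-leaf (inj₂ y) adj))

  sub : ∀ {x₁ x₂} → x₁ <ᶠ r → r <ᶠ x₂ → A x₁ c ≡ 1ℤ → A x₂ c ≡ 1ℤ →
        ∀ p q → A (triple x₁ r x₂ p) (γ q) ≡ D₃ p q
  sub lt lt′ e e′ 0F 0F = col-leaf _ 0F (λ ()) (λ eq → ℕ.<⇒≢ lt (cong toℕ eq))
  sub lt lt′ e e′ 0F 1F = e
  sub lt lt′ e e′ 0F 2F = col-leaf _ 2F (λ ()) (λ eq → ℕ.<⇒≢ lt (cong toℕ eq))
  sub lt lt′ e e′ 1F 0F = ua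
  sub lt lt′ e e′ 1F 1F = uv
  sub lt lt′ e e′ 1F 2F = ub
  sub lt lt′ e e′ 2F 0F = col-leaf _ 0F (λ ()) (λ eq → ℕ.<⇒≢ lt′ (cong toℕ (sym eq)))
  sub lt lt′ e e′ 2F 1F = e′
  sub lt lt′ e e′ 2F 2F = col-leaf _ 2F (λ ()) (λ eq → ℕ.<⇒≢ lt′ (cong toℕ (sym eq)))

  site : _ ⊎ _ → Site A
  site (inj₁ ((x<r , gap) , r<x′)) = record
    { ρ = triple x r x′ ; γ = γ
    ; ρ-inc = triple-increasing x<r r<x′ ; γ-inc = triple-increasing a<v v<b
    ; sub = sub x<r r<x′ vw vw′ ; s = above
    ; centre = centre ; row-leaf = row-leaf ; col-leaf = col-leaf
    ; gap = λ y l r → zero-unless λ adj → gap (inj₁ y) adj l r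
    }
  site (inj₂ ((r<x , gap) , x′<r)) = record
    { ρ = triple x′ r x ; γ = γ
    ; ρ-inc = triple-increasing x′<r r<x ; γ-inc = triple-increasing a<v v<b
    ; sub = sub x′<r r<x vw′ vw ; s = below
    ; centre = centre ; row-leaf = row-leaf ; col-leaf = col-leaf
    ; gap = λ y l r → zero-unless λ adj → gap (inj₁ y) adj l r
    }

Detached : ∀ {n} → Matrix (suc (suc n)) → Set
Detached {n} A = Σ (Matrix n) λ B → ConnectedASM B × AttachD₃ B A

detach-site : ∀ {n} (A : Matrix (suc (suc n))) → ConnectedASM A → Site A → Detached A
detach-site A (asm , conn) site = reduced , (reduced-asm , reduced-connected conn) , attach
  where open Detach A asm site

detach-hub : ∀ {n} (A : Matrix (suc (suc n))) → ConnectedASM A → HubSite A → Detached A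
detach-hub A casm H with HubSite.u H in eq
... | inj₁ _ = detach-site A casm (row-site H eq)
... | inj₂ _ with B , (asm , conn) , att ← detach-site (transpose A)
                    (transpose-asm (proj₁ casm) , transpose-connected (proj₂ casm))
                    (row-site (transpose-hub H) (cong swap eq)) =
        transpose B , (transpose-asm asm , transpose-connected conn) , transpose-attach att

module _ {n} (A : Matrix n) (asm : IsASM A) where
  open Graph A
  open ASM asm

  two-positives : ∀ {u x y z} → negatives u ≡ 1 → x ≢ y → u ∙ x ≡ 1ℤ → u ∙ y ≡ 1ℤ → u ∙ z ≡ 1ℤ →
                  z ≡ x ⊎ z ≡ y
  two-positives {u} one x≢y px py pz =
    #-2⇒either (λ v → u ∙ v ℤ.≟ 1ℤ) _≟ᵛ_ (trans (balance u) (cong suc one)) x≢y px py pz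

  -- A -1 lies between two +1's on each of its two lines. On the line of `u` these are the leaves of
  -- the hub; on the line of `v` the +1 away from `w` serves as the entry to which `D₃` was
  -- attached.
  hub-site : Detachable → HubSite A
  hub-site (u , v , w , h@(one , leaves) , uv , leaf , vw , near)
    with a , ua , (a<v , _) ← prev⁺ u uv | b , ub , (v<b , _) ← next⁺ u uv = record
    { u = u ; v = v ; a = a ; b = b ; w = w ; w′ = proj₁ w′∃
    ; uv = uv ; ua = ua ; ub = ub ; vw = vw ; vw′ = proj₁ (proj₂ w′∃)
    ; a<v = a<v ; v<b = v<b
    ; u-nbrs = u-nbrs
    ; a-leaf = λ x adj → leaf-unique {a} (leaves a ua) adj (adj⁺ {a} {u} (∙-sym-≡ {u} {a} ua))
    ; b-leaf = λ x adj → leaf-unique {b} (leaves b ub) adj (adj⁺ {b} {u} (∙-sym-≡ {u} {b} ub))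
    ; w-leaf = λ x adj → leaf-unique {w} leaf adj (adj⁺ {w} {v} (∙-sym-≡ {v} {w} vw))
    ; order = proj₂ (proj₂ w′∃)
    }
    where
    u-nbrs : ∀ x → Adj A u x → x ≡ a ⊎ x ≡ v ⊎ x ≡ b
    u-nbrs x adj with adj-sign {u} {x} adj
    ... | inj₂ m = inj₂ (inj₁ (hub-unique {u} h m uv))
    ... | inj₁ p with two-positives {u} one (λ { refl → ℕ.<-asym a<v v<b }) ua ub p
    ...   | inj₁ e = inj₁ e
    ...   | inj₂ e = inj₂ (inj₂ e)

    vu : v ∙ u ≡ -1ℤ
    vu = ∙-sym-≡ {u} {v} uv

    w′∃ : ∃ λ w′ → v ∙ w′ ≡ 1ℤ × ((Near v w u × ix u < ix w′) ⊎ (Near v u w × ix w′ < ix u))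
    w′∃ = case near of λ
      { (inj₁ uw) → let z , p , lt , _ = prev⁺ v vu in z , p , inj₂ (uw , lt)
      ; (inj₂ wu) → let z , p , lt , _ = next⁺ v vu in z , p , inj₁ (wu , lt) }

detach : ∀ {n} (A : Matrix (suc (suc n))) → ConnectedASM A → Graph.Detachable A → Detached A
detach A casm d = detach-hub A casm (hub-site A (proj₁ casm) d)

-- Discharging

ind-disjoint : ∀ {P Q R E : Set} (p : Dec P) (q : Dec Q) (r : Dec R) (e : Dec E) →
               (P → E) → (Q → E) → (R → E) → ¬ (P × Q) → ¬ (P × R) → ¬ (Q × R) →
               ind p + ind q + ind r ≤ ind e
ind-disjoint (yes p) (yes q) _ _ _ _ _ pq _ _ = contradiction (p , q) pq
ind-disjoint (yes p) (no _) (yes r) _ _ _ _ _ pr _ = contradiction (p , r) pr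
ind-disjoint (no _) (yes q) (yes r) _ _ _ _ _ _ qr = contradiction (q , r) qr
ind-disjoint (yes p) (no _) (no _) e f _ _ _ _ _ = ℕ.≤-reflexive (sym (ind-yes e (f p)))
ind-disjoint (no _) (yes q) (no _) e _ f _ _ _ _ = ℕ.≤-reflexive (sym (ind-yes e (f q)))
ind-disjoint (no _) (no _) (yes r) e _ _ f _ _ _ = ℕ.≤-reflexive (sym (ind-yes e (f r)))
ind-disjoint (no _) (no _) (no _) e _ _ _ _ _ _ = z≤n

module Irreducible {n} (A : Matrix n) (asm : IsASM A) (conn : Connected A)
                   (v₀ : Vtx n) (another : ∀ (i : Fin n) → ∃ λ j → j ≢ i)
                   (irreducible : ¬ Graph.Detachable A) where
  open Graph A public
  open ASM asm public

  -- Two adjacent leaves would be a whole component of the graph, while `another` supplies a vertex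
  -- outside it.
  leaf-leaf : ∀ {u v} → Leaf u → Leaf v → ¬ Adj A u v
  leaf-leaf {u} {v} lu lv adj =
    let w , w≢u , w≢v = outside u v adj in [ w≢u , w≢v ]′ (closed (conn u w) (inj₁ refl))
    where
    outside : ∀ u v → Adj A u v → ∃ λ w → w ≢ u × w ≢ v
    outside (inj₁ i) (inj₁ _) adj = contradiction refl adj
    outside (inj₁ i) (inj₂ j) _   =
      let k , k≢i = another i in inj₁ k , (λ eq → k≢i (Sum⊎.inj₁-injective eq)) , λ ()
    outside (inj₂ j) (inj₂ _) adj = contradiction refl adj
    outside (inj₂ j) (inj₁ i) _   =
      let k , k≢j = another j in inj₂ k , (λ eq → k≢j (Sum⊎.inj₂-injective eq)) , λ ()

    closed : ∀ {x y} → Star (Adj A) x y → x ≡ u ⊎ x ≡ v → y ≡ u ⊎ y ≡ v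
    closed ε at = at
    closed {y = y} (_◅_ {j = z} a path) (inj₁ refl) = closed path (inj₂ (leaf-unique {u} {z} {v} lu a adj))
    closed (_◅_ {j = z} a path) (inj₂ refl) =
      closed path (inj₁ (leaf-unique {v} {z} {u} lv a (adj-sym {u} {v} adj)))

  -- Along a positive edge the neighbour of a hub is a leaf. Along a negative edge the next +1 of
  -- the line of `v` after `u` is a leaf, as `v` is a hub, so a `D₃` could be detached.
  hub-hub : ∀ {u v} → Hub u → Hub v → ¬ Adj A u v
  hub-hub {u} {v} hu hv@(_ , leaves) adj with adj-sign {u} {v} adj
  ... | inj₁ p = hub-positive-nbr {u} {v} hu p hv
  ... | inj₂ uv with z , vz , near ← next⁺ v {u} (∙-sym-≡ {u} {v} uv) =
        irreducible (u , v , z , hu , uv , leaves z vz , vz , inj₁ near)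

  hub-core : ∀ {u v} → Hub u → u ∙ v ≡ -1ℤ → Core v
  hub-core {u} {v} hu uv = ∙⁻-not-leaf {v} {u} (∙-sym-≡ {u} {v} uv) ,
                           λ hv → hub-hub {u} {v} hu hv (adj⁻ {u} {v} uv)

  positive-not-hub : ∀ {u v} → ¬ Leaf u → u ∙ v ≡ 1ℤ → ¬ Hub v
  positive-not-hub {u} {v} ¬lu uv (_ , leaves) = ¬lu (leaves u (∙-sym-≡ {u} {v} uv))

  beside-hub : ∀ {u v w} → Hub u → v ∙ u ≡ -1ℤ → v ∙ w ≡ 1ℤ → Near v u w ⊎ Near v w u → Core w
  beside-hub {u} {v} {w} hu vu vw near =
    (λ lw → irreducible (u , v , w , hu , ∙-sym-≡ {v} {u} vu , lw , vw , near)) ,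
    positive-not-hub {v} {w} (∙⁻-not-leaf {v} {u} vu) vw

  negative-hub-or-core : ∀ {u v} → u ∙ v ≡ -1ℤ → Hub v ⊎ Core v
  negative-hub-or-core {u} {v} uv with leaf⊎hub⊎core v
  ... | inj₁ l = contradiction l (∙⁻-not-leaf {v} {u} (∙-sym-≡ {u} {v} uv))
  ... | inj₂ r = r

  positive-leaf-or-core : ∀ {u v} → ¬ Leaf u → u ∙ v ≡ 1ℤ → Leaf v ⊎ Core v
  positive-leaf-or-core {u} {v} ¬lu uv with leaf⊎hub⊎core v
  ... | inj₁ l        = inj₁ l
  ... | inj₂ (inj₁ h) = contradiction h (positive-not-hub {u} {v} ¬lu uv)
  ... | inj₂ (inj₂ c) = inj₂ c

  CoreEdge : Vtx n → Vtx n → Set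
  CoreEdge u v = Core u × Core v × Adj A u v

  coreEdge? : ∀ u v → Dec (CoreEdge u v)
  coreEdge? u v = core? u ×-dec core? v ×-dec adj? u v

  abstract
    -- If some -1 of `u` leads to a hub, the +1's enclosing it lead to the core. If not, all -1's
    -- lead to the core, and two of them suffice. With a single -1, some +1 must lead to the core as
    -- well, for otherwise all +1's would lead to leaves and `u` would be a hub.
    two-core-nbrs : ∀ {u} → Core u → ∃ λ a → ∃ λ b → a ≢ b × CoreEdge u a × CoreEdge u b
    two-core-nbrs {u} cu@(¬lu , ¬hu) with anyᵛ? (λ x → hub? x ×-dec (u ∙ x ℤ.≟ -1ℤ))
    ... | yes (x , hx , ux)
        with y , uy , near ← prev⁺ u {x} ux | z , uz , near′ ← next⁺ u {x} ux =
          y , z , (λ { refl → ℕ.<-asym (proj₁ near) (proj₁ near′) })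
            , (cu , beside-hub {x} {u} {y} hx ux uy (inj₂ near) , adj⁺ {u} {y} uy)
            , (cu , beside-hub {x} {u} {z} hx ux uz (inj₁ near′) , adj⁺ {u} {z} uz)
    ... | no no-hub = by-negatives _ refl (#-enum (λ v → u ∙ v ℤ.≟ -1ℤ))
      where
      negative-core : ∀ {v} → u ∙ v ≡ -1ℤ → CoreEdge u v
      negative-core {v} uv with negative-hub-or-core {u} {v} uv
      ... | inj₁ h = contradiction (v , h , uv) no-hub
      ... | inj₂ c = cu , c , adj⁻ {u} {v} uv

      by-negatives : ∀ k → negatives u ≡ k → Enum k (λ v → u ∙ v ≡ -1ℤ) →
                     ∃ λ a → ∃ λ b → a ≢ b × CoreEdge u a × CoreEdge u b
      by-negatives zero          none _ = contradiction none ¬lu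
      by-negatives (suc (suc k)) _    E =
        at 0F , at 1F , (λ e → case at-inj e of λ ()) , negative-core (at-sat 0F) , negative-core (at-sat 1F)
        where open Enum E
      by-negatives (suc zero) one E with anyᵛ? (λ v → (u ∙ v ℤ.≟ 1ℤ) ×-dec core? v)
      ... | yes (v , uv , cv) = v , at 0F , (λ { refl → ⁺≢⁻ {u} {v} uv (at-sat 0F) })
                              , (cu , cv , adj⁺ {u} {v} uv) , negative-core (at-sat 0F)
        where open Enum E
      ... | no no-core = contradiction (one , leaves) ¬hu
        where
        leaves : ∀ v → u ∙ v ≡ 1ℤ → Leaf v
        leaves v uv with positive-leaf-or-core {u} {v} ¬lu uv
        ... | inj₁ l = l
        ... | inj₂ c = contradiction (v , uv , c) no-core

  -- Every edge outside the core is charged to its end u farther from the core.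
  Pendant : Vtx n → Vtx n → Set
  Pendant u v = (Leaf u × u ∙ v ≡ 1ℤ) ⊎ (Hub u × u ∙ v ≡ -1ℤ)

  pendant? : ∀ u v → Dec (Pendant u v)
  pendant? u v = (leaf? u ×-dec (u ∙ v ℤ.≟ 1ℤ)) ⊎-dec (hub? u ×-dec (u ∙ v ℤ.≟ -1ℤ))

  pendant-adj : ∀ {u v} → Pendant u v → Adj A u v
  pendant-adj {u} {v} (inj₁ (_ , p)) = adj⁺ {u} {v} p
  pendant-adj {u} {v} (inj₂ (_ , m)) = adj⁻ {u} {v} m

  pendant-not-core : ∀ {u v} → Pendant u v → ¬ Core u
  pendant-not-core (inj₁ (l , _)) (¬l , _) = ¬l l
  pendant-not-core (inj₂ (h , _)) (_ , ¬h) = ¬h h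

  pendant-asym : ∀ {u v} → ¬ (Pendant u v × Pendant v u)
  pendant-asym {u} {v} (inj₁ (l , p) , inj₁ (l′ , _)) = leaf-leaf {u} {v} l l′ (adj⁺ {u} {v} p)
  pendant-asym {u} {v} (inj₁ (_ , p) , inj₂ (_ , m))  = ⁺≢⁻ {u} {v} p (∙-sym-≡ {v} {u} m)
  pendant-asym {u} {v} (inj₂ (_ , m) , inj₁ (_ , p))  = ⁺≢⁻ {u} {v} (∙-sym-≡ {v} {u} p) m
  pendant-asym {u} {v} (inj₂ (h , m) , inj₂ (h′ , _)) = hub-hub {u} {v} h h′ (adj⁻ {u} {v} m)

  -- A pendant edge counts twice at the end that bears its charge, a core edge once at each end. The
  -- total is then comparable with the sum of degrees, and every vertex receives at least 2.
  weight : Vtx n → ℕ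
  weight u = # (pendant? u) + # (pendant? u) + # (coreEdge? u)

  2≤weight : ∀ u → 2 ≤ weight u
  2≤weight u with leaf⊎hub⊎core u
  ... | inj₁ l with v , uv ← positive-nbr u =
        ℕ.≤-trans (ℕ.+-mono-≤ 1≤ 1≤) (ℕ.m≤m+n (# (pendant? u) + # (pendant? u)) (# (coreEdge? u)))
    where 1≤ = #-≥1 (pendant? u) {v} (inj₁ (l , uv))
  ... | inj₂ (inj₁ h) with v , uv ← hub-negative {u} h =
        ℕ.≤-trans (ℕ.+-mono-≤ 1≤ 1≤) (ℕ.m≤m+n (# (pendant? u) + # (pendant? u)) (# (coreEdge? u)))
    where 1≤ = #-≥1 (pendant? u) {v} (inj₂ (h , uv))
  ... | inj₂ (inj₂ c) with a , b , a≢b , ca , cb ← two-core-nbrs {u} c =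
        ℕ.≤-trans (#-≥2 (coreEdge? u) ca cb a≢b) (ℕ.m≤n+m (# (coreEdge? u)) (# (pendant? u) + # (pendant? u)))

  ∑-weight : ∑ els weight ≤ nnz A + nnz A
  ∑-weight = begin
    ∑ els weight
      ≡⟨ ∑-+ els (λ u → # (pendant? u) + # (pendant? u)) (λ u → # (coreEdge? u)) ⟩
    ∑ els (λ u → # (pendant? u) + # (pendant? u)) + ∑ els (λ u → # (coreEdge? u))
      -- Exchanging the summations in one of the two pendant terms reads the charge from the other
      -- end of the edge. Each ordered pair then has three possible contributions, which exclude one
      -- another.
      ≡⟨ cong (λ z → z + ∑ els (λ u → # (coreEdge? u))) (trans (∑-+ els (λ u → # (pendant? u)) _)
           (trans (cong (λ z → ∑ els (λ u → # (pendant? u)) + z) (∑-comm els els (λ u v → ind (pendant? u v))))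
                  (sym (∑-+ els (λ u → # (pendant? u)) _)))) ⟩
    ∑ els (λ u → # (pendant? u) + # (λ v → pendant? v u)) + ∑ els (λ u → # (coreEdge? u))
      ≡⟨ sym (∑-+ els (λ u → # (pendant? u) + # (λ v → pendant? v u)) _) ⟩
    ∑ els (λ u → # (pendant? u) + # (λ v → pendant? v u) + # (coreEdge? u))
      ≡⟨ ∑-cong els (λ u → trans (cong (λ z → z + # (coreEdge? u))
                                    (sym (∑-+ els (λ v → ind (pendant? u v)) _)))
                                 (sym (∑-+ els (λ v → ind (pendant? u v) + ind (pendant? v u)) _))) ⟩
    ∑ els (λ u → ∑ els (λ v → ind (pendant? u v) + ind (pendant? v u) + ind (coreEdge? u v)))
      ≤⟨ ∑-mono-≤ els (λ u → ∑-mono-≤ els (λ v → charges u v)) ⟩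
    ∑ els (λ u → ∑ els (λ v → ind (adj? u v)))
      ≡⟨ handshake ⟩
    nnz A + nnz A ∎
    where
    open ℕ.≤-Reasoning
    charges : ∀ u v → ind (pendant? u v) + ind (pendant? v u) + ind (coreEdge? u v) ≤ ind (adj? u v)
    charges u v = ind-disjoint (pendant? u v) (pendant? v u) (coreEdge? u v) (adj? u v)
      (pendant-adj {u} {v}) (λ p → adj-sym {v} {u} (pendant-adj {v} {u} p)) (proj₂ ∘ proj₂)
      (pendant-asym {u} {v}) (λ (p , c , _) → pendant-not-core {u} {v} p c)
      (λ (p , _ , c , _) → pendant-not-core {v} {u} p c)

  private
    ∑-two : ∑ els (λ _ → 2) ≡ 2 * n + 2 * n
    ∑-two = trans (∑-const els 2) (trans (cong (λ z → z * 2) size)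
              (solve 1 (λ n → (n :+ n) :* con 2 := con 2 :* n :+ con 2 :* n) refl n))
      where open +-*-Solver

  nnz-bound : 2 * n ≤ nnz A
  nnz-bound = ℕ.≮⇒≥ λ lt → ℕ.<⇒≱ (ℕ.+-mono-< lt lt)
    (subst (λ z → z ≤ nnz A + nnz A) ∑-two (ℕ.≤-trans (∑-mono-≤ els 2≤weight) ∑-weight))

  module Tight (tight : nnz A ≡ 2 * n) where

    weight≤2 : ∀ u → weight u ≤ 2
    weight≤2 u = ∑-tight els 2≤weight
      (subst (λ z → ∑ els weight ≤ z) (trans (cong (λ z → z + z) tight) (sym ∑-two)) ∑-weight) (all∈ u)

    abstract
      -- In the equality case `u` has weight exactly 2, all of it used by the edges to `a` and `b`.
      core-nbrs : ∀ {u a b w} → a ≢ b → CoreEdge u a → CoreEdge u b → CoreEdge u w → w ≡ a ⊎ w ≡ b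
      core-nbrs {u} a≢b ca cb cw = #-2⇒either (coreEdge? u) _≟ᵛ_
        (ℕ.≤-antisym (ℕ.≤-trans (ℕ.m≤n+m (# (coreEdge? u)) (# (pendant? u) + # (pendant? u))) (weight≤2 u)) (#-≥2 (coreEdge? u) ca cb a≢b))
        a≢b ca cb cw

    abstract
      -- The neighbour of a leaf is a hub or core, and the negative neighbour of a hub is core, so
      -- the core is reached from `v₀` in at most two steps.
      some-core : ∃ Core
      some-core with leaf⊎hub⊎core v₀
      ... | inj₂ (inj₂ c) = v₀ , c
      ... | inj₂ (inj₁ h) with v , uv ← hub-negative {v₀} h = v , hub-core {v₀} {v} h uv
      ... | inj₁ l with v , uv ← positive-nbr v₀ with leaf⊎hub⊎core v
      ...   | inj₁ l′        = contradiction (adj⁺ {v₀} {v} uv) (leaf-leaf {v₀} {v} l l′)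
      ...   | inj₂ (inj₂ c)  = v , c
      ...   | inj₂ (inj₁ h)  with w , vw ← hub-negative {v} h = w , hub-core {v} {w} h vw

-- Basic unicyclic graphs

double-injective : ∀ {a b} → a + a ≡ b + b → a ≡ b
double-injective {a} {b} eq with ℕ.<-cmp a b
... | tri< lt _ _ = contradiction eq (ℕ.<⇒≢ (ℕ.+-mono-< lt lt))
... | tri≈ _ e _  = e
... | tri> _ _ gt = contradiction (sym eq) (ℕ.<⇒≢ (ℕ.+-mono-< gt gt))

module _ (k : ℕ) where

  4≤cycLen : 4 ≤ cycLen k
  4≤cycLen = ℕ.+-mono-≤ (s≤s (s≤s (z≤n {k}))) (s≤s (s≤s (z≤n {k})))

  next-toℕ : ∀ t → (suc (toℕ t) < cycLen k × toℕ (next k t) ≡ suc (toℕ t)) ⊎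
                   (suc (toℕ t) ≡ cycLen k × toℕ (next k t) ≡ 0)
  next-toℕ t with ℕ.m≤n⇒m<n∨m≡n (Fin.toℕ<n t)
  ... | inj₁ lt = inj₁ (lt , trans (Fin.toℕ-fromℕ< _) (m<n⇒m%n≡m lt))
  ... | inj₂ eq = inj₂ (eq , trans (Fin.toℕ-fromℕ< _)
                    (trans (cong (λ z → z % cycLen k) eq) (n%n≡0 (cycLen k))))

  next-prev : ∀ t → next k (prev k t) ≡ t
  next-prev t = Fin.toℕ-injective (trans (Fin.toℕ-fromℕ< _)
    (trans (cong (λ z → suc z % cycLen k) prev-toℕ) (wrap t)))
    where
    L = cycLen k

    prev-toℕ : toℕ (prev k t) ≡ (toℕ t + suc (suc (suc (k + k)))) % L
    prev-toℕ = Fin.toℕ-fromℕ< _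

    -- The shift in `prev` is 2m - 1 with m = k + 2, so one more step completes the full length 2m.
    last : suc (suc (suc (suc (k + k)))) ≡ L
    last = solve 1 (λ k → con 4 :+ (k :+ k) := (con 2 :+ k) :+ (con 2 :+ k)) refl k
      where open +-*-Solver

    predecessor : ∀ x → suc x < L → (suc x + suc (suc (suc (k + k)))) % L ≡ x
    predecessor x lt = trans
      (cong (λ z → z % L) (trans (sym (ℕ.+-suc x _)) (cong (λ z → x + z) last)))
      (trans ([m+n]%n≡m%n x L) (m<n⇒m%n≡m (ℕ.<⇒≤ lt)))

    wrap : ∀ (t : Fin L) → suc ((toℕ t + suc (suc (suc (k + k)))) % L) % L ≡ toℕ t
    wrap zero = trans (cong (λ z → suc z % L) (m<n⇒m%n≡m (ℕ.≤-reflexive last)))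
                      (trans (cong (λ z → z % L) last) (n%n≡0 L))
    wrap (suc t) = trans (cong (λ z → suc z % L) (predecessor (toℕ t) (s≤s (Fin.toℕ<n t))))
                         (m<n⇒m%n≡m (s≤s (Fin.toℕ<n t)))

  -- Length at least 4 excludes a cycle of two vertices, on which successor and predecessor
  -- coincide. This keeps the cycle edges distinct and the two core neighbours of a cycle vertex
  -- apart.
  next-next≢ : ∀ t → next k (next k t) ≢ t
  next-next≢ t eq = impossible (toℕ t) (toℕ (next k t)) (toℕ (next k (next k t)))
                      (next-toℕ t) (next-toℕ (next k t)) (cong toℕ eq) 4≤cycLen
    where
    impossible : ∀ {L} x y z → (suc x < L × y ≡ suc x) ⊎ (suc x ≡ L × y ≡ 0) →
                 (suc y < L × z ≡ suc y) ⊎ (suc y ≡ L × z ≡ 0) → z ≡ x → ¬ 4 ≤ L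
    impossible x _ _ (inj₁ (_ , refl)) (inj₁ (_ , refl)) eq _ =
      ℕ.<⇒≢ (ℕ.m≤n⇒m≤1+n ℕ.≤-refl) (sym eq)
    impossible _ _ _ (inj₁ (_ , refl)) (inj₂ (refl , refl)) refl (s≤s (s≤s ()))
    impossible _ _ _ (inj₂ (refl , refl)) (inj₁ (_ , refl)) refl (s≤s (s≤s ()))
    impossible _ _ _ (inj₂ (_ , refl)) (inj₂ (refl , _)) _ (s≤s ())

localParent : ∀ κ → Deco κ → Maybe (Deco κ)
localParent PP    0F            = nothing
localParent PP    (suc _)       = just 0F
localParent Mixed _             = nothing
localParent NN    _             = nothing

localEdge-parent : ∀ {κ m x z} → LocalEdge κ m x z → localParent κ x ≡ m
localEdge-parent pp-w   = refl
localEdge-parent pp-l1  = refl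
localEdge-parent pp-l2  = refl
localEdge-parent mx     = refl
localEdge-parent (nn _) = refl

parent-localEdge : ∀ κ x → ∃ λ z → z ≢ 0ℤ × LocalEdge κ (localParent κ x) x z
parent-localEdge PP    0F = -1ℤ , (λ ()) , pp-w
parent-localEdge PP    1F = 1ℤ , (λ ()) , pp-l1
parent-localEdge PP    2F = 1ℤ , (λ ()) , pp-l2
parent-localEdge Mixed 0F = 1ℤ , (λ ()) , mx
parent-localEdge NN    x  = 1ℤ , (λ ()) , nn x

-- Decorations have depth at most two: only the two leaves of the hub in kind `PP` hang from another
-- decoration.
parent-of-parent : ∀ κ {x y} → localParent κ x ≡ just y → localParent κ y ≡ nothing
parent-of-parent PP {suc _} refl = refl

module _ (k : ℕ) (s : Fin (cycLen k) → Bool) where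

  hang : (t : Fin (cycLen k)) → Maybe (Deco (kind k s t)) → TVtx k s
  hang t nothing  = inj₁ t
  hang t (just y) = inj₂ (t , y)

  parent : TVtx k s → TVtx k s
  parent (inj₁ t)       = inj₁ (next k t)
  parent (inj₂ (t , x)) = hang t (localParent (kind k s t) x)

  tedge-parent : ∀ {a b z} → TEdge k s a b z → parent a ≡ b ⊎ parent b ≡ a
  tedge-parent (cyc t)           = inj₁ refl
  tedge-parent (hub t x z e)     = inj₂ (cong (hang t) (localEdge-parent e))
  tedge-parent (inner t x y z e) = inj₂ (cong (hang t) (localEdge-parent e))

  tadj-parent : ∀ {a b z} → TAdj k s a b z → parent a ≡ b ⊎ parent b ≡ a
  tadj-parent (inj₁ e) = tedge-parent e
  tadj-parent (inj₂ e) = swap (tedge-parent e)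

  sgn≢0 : ∀ b → sgn b ≢ 0ℤ
  sgn≢0 true  ()
  sgn≢0 false ()

  parent-tadj : ∀ a → ∃ λ z → z ≢ 0ℤ × TAdj k s a (parent a) z
  parent-tadj (inj₁ t) = sgn (s t) , sgn≢0 (s t) , inj₁ (cyc t)
  parent-tadj (inj₂ (t , x))
    with localParent (kind k s t) x | parent-localEdge (kind k s t) x
  ... | nothing | z , z≢0 , e = z , z≢0 , inj₂ (hub t x z e)
  ... | just y  | z , z≢0 , e = z , z≢0 , inj₂ (inner t y x z e)

  parent-parent≢ : ∀ a → parent (parent a) ≢ a
  parent-parent≢ (inj₁ t) eq = next-next≢ k t (Sum⊎.inj₁-injective eq)
  parent-parent≢ (inj₂ (t , x)) eq with localParent (kind k s t) x in par
  ... | nothing with () ← eq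
  ... | just y rewrite parent-of-parent (kind k s t) par with () ← eq

-- A unicyclic graph has one edge {u, parent u} for each vertex u, the cycle being oriented by next.
unicyclic-nnz : ∀ {n} {A : Matrix n} → IsBasicUnicyclic A → nnz A ≡ 2 * n
unicyclic-nnz {n} {A} uni = double-injective (begin
  nnz A + nnz A
    ≡⟨ sym handshake ⟩
  ∑ els (λ u → ∑ els (λ v → ind (adj? u v)))
    ≡⟨ ∑-cong els (λ u → trans (∑-cong els (edge-count u)) (∑-+ els (λ v → ind (par u ≟ᵛ v)) _)) ⟩
  ∑ els (λ u → # (par u ≟ᵛ_) + ∑ els (λ v → ind (par v ≟ᵛ u)))
    ≡⟨ ∑-+ els (λ u → # (par u ≟ᵛ_)) _ ⟩
  ∑ els (λ u → # (par u ≟ᵛ_)) + ∑ els (λ u → ∑ els (λ v → ind (par v ≟ᵛ u)))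
    ≡⟨ cong (λ z → ∑ els (λ u → # (par u ≟ᵛ_)) + z) (∑-comm els els (λ u v → ind (par v ≟ᵛ u))) ⟩
  ∑ els (λ u → # (par u ≟ᵛ_)) + ∑ els (λ u → # (par u ≟ᵛ_))
    ≡⟨ cong (λ z → z + z) (trans (∑-cong els (λ u → one (par u))) (trans (∑-const els 1)
         (trans (ℕ.*-identityʳ _) (trans size (cong (λ z → n + z) (sym (ℕ.+-identityʳ n))))))) ⟩
  2 * n + 2 * n ∎)
  where
  open ≡-Reasoning
  open IsBasicUnicyclic uni
  open Inverse iso using (to; from; strictlyInverseˡ; strictlyInverseʳ)
  open Graph A

  par : Vtx n → Vtx n
  par u = from (parent k s (to u))

  one : ∀ v → # (v ≟ᵛ_) ≡ 1
  one v = enum-size (#-enum (v ≟ᵛ_)) record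
    { at = λ _ → v ; at-inj = λ { {0F} {0F} _ → refl } ; at-sat = λ _ → refl
    ; at-all = λ _ eq → 0F , eq }

  par-adj : ∀ u → Adj A u (par u)
  par-adj u eq with z , z≢0 , adj ← parent-tadj k s (to u) =
    z≢0 (trans (sym (Equivalence.from (edges u (par u) z z≢0)
      (subst (λ w → TAdj k s (to u) w z) (sym (strictlyInverseˡ _)) adj))) eq)

  to-par : ∀ {u v} → parent k s (to u) ≡ to v → par u ≡ v
  to-par eq = trans (cong from eq) (strictlyInverseʳ _)

  par-to : ∀ {u v} → par u ≡ v → parent k s (to u) ≡ to v
  par-to eq = trans (sym (strictlyInverseˡ _)) (cong to eq)

  adj-par : ∀ {u v} → Adj A u v → par u ≡ v ⊎ par v ≡ u
  adj-par {u} {v} adj with tadj-parent k s (Equivalence.to (edges u v _ adj) refl)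
  ... | inj₁ eq = inj₁ (to-par eq)
  ... | inj₂ eq = inj₂ (to-par eq)

  edge-count : ∀ u v → ind (adj? u v) ≡ ind (par u ≟ᵛ v) + ind (par v ≟ᵛ u)
  edge-count u v with par u ≟ᵛ v | par v ≟ᵛ u
  -- An edge counted from both ends would make `parent` return to `to u` after two steps.
  ... | yes e | yes e′ = contradiction (trans (cong (parent k s) (par-to e)) (par-to e′))
                                       (parent-parent≢ k s (to u))
  ... | yes refl | no _ = ind-yes (adj? u v) (par-adj u)
  ... | no _ | yes refl = ind-yes (adj? u v) (adj-sym {v} {u} (par-adj v))
  ... | no ¬e | no ¬e′  = ind-no (adj? u v) (λ adj → [ ¬e , ¬e′ ]′ (adj-par {u} {v} adj))

-- The core of an extremal matrix

module Unicyclic {n} (A : Matrix n) (asm : IsASM A) (conn : Connected A)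
                 (v₀ : Vtx n) (another : ∀ (i : Fin n) → ∃ λ j → j ≢ i)
                 (irreducible : ¬ Graph.Detachable A) (tight : nnz A ≡ 2 * n) where
  open Irreducible A asm conn v₀ another irreducible
  open Tight tight

  coreEdge-sym : ∀ {u v} → CoreEdge u v → CoreEdge v u
  coreEdge-sym {u} {v} (cu , cv , adj) = cv , cu , adj-sym {u} {v} adj

  core-not-leaf : ∀ {u} → Leaf u → ¬ Core u
  core-not-leaf l (¬l , _) = ¬l l

  core-not-hub : ∀ {u} → Hub u → ¬ Core u
  core-not-hub h (_ , ¬h) = ¬h h

  ix-injective : ∀ {u v w} → Adj A u v → Adj A u w → ix v ≡ ix w → v ≡ w
  ix-injective {inj₁ _} {inj₁ _}          p q eq = contradiction refl p
  ix-injective {inj₁ _} {inj₂ _} {inj₁ _} p q eq = contradiction refl q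
  ix-injective {inj₁ _} {inj₂ _} {inj₂ _} p q eq = cong inj₂ (Fin.toℕ-injective eq)
  ix-injective {inj₂ _} {inj₂ _}          p q eq = contradiction refl p
  ix-injective {inj₂ _} {inj₁ _} {inj₂ _} p q eq = contradiction refl q
  ix-injective {inj₂ _} {inj₁ _} {inj₁ _} p q eq = cong inj₁ (Fin.toℕ-injective eq)

  record Around (u x : Vtx n) : Set where
    field
      y z   : Vtx n
      uy    : u ∙ y ≡ 1ℤ
      uz    : u ∙ z ≡ 1ℤ
      y<x   : ix y < ix x
      x<z   : ix x < ix z
      gap   : ∀ w → Adj A u w → ix x < ix w → ¬ ix w < ix z
      cy    : CoreEdge u y
      cz    : CoreEdge u z

    y≢z : y ≢ z
    y≢z eq = ℕ.<⇒≢ (ℕ.<-trans y<x x<z) (cong ix eq)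

  abstract
    around : ∀ {u x} → Core u → Hub x → u ∙ x ≡ -1ℤ → Around u x
    around {u} {x} cu hx ux
      with y , uy , near ← prev⁺ u {x} ux | z , uz , near′ ← next⁺ u {x} ux = record
      { y = y ; z = z ; uy = uy ; uz = uz ; y<x = proj₁ near ; x<z = proj₁ near′ ; gap = proj₂ near′
      ; cy = cu , beside-hub {x} {u} {y} hx ux uy (inj₂ near) , adj⁺ {u} {y} uy
      ; cz = cu , beside-hub {x} {u} {z} hx ux uz (inj₁ near′) , adj⁺ {u} {z} uz
      }

    -- Suppose x precedes x′. The +1's y and z around x and the +1 z′ after x′ are all core, and z
    -- comes no later than x′ because nothing lies between x and z. So y < x < z ≤ x′ < z′ exhibits
    -- three core neighbours of `u`, one too many.
    hubs-not-ordered : ∀ {u x x′} → Core u → Hub x → u ∙ x ≡ -1ℤ → Hub x′ → u ∙ x′ ≡ -1ℤ →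
                       ¬ ix x < ix x′
    hubs-not-ordered {u} {x} {x′} cu hx ux hx′ ux′ x<x′ =
      [ (λ eq → ℕ.<⇒≢ (ℕ.<-trans y<x (ℕ.<-trans x<x′ (x<z a′))) (cong ix (sym eq)))
      , (λ eq → ℕ.<⇒≱ (x<z a′) (subst (_≤ ix x′) (cong ix (sym eq)) z≤x′)) ]′ (core-nbrs {u} {w = Around.z a′} y≢z cy cz₀ (cz a′))
      where
      a′ : Around u x′
      a′ = around {u} {x′} cu hx′ ux′
      open Around (around {u} {x} cu hx ux) using (y; z; y<x; y≢z; cy; gap) renaming (cz to cz₀)
      open Around using (x<z; cz)
      z≤x′ : ix z ≤ ix x′
      z≤x′ = ℕ.≮⇒≥ (gap x′ (adj⁻ {u} {x′} ux′) x<x′)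

  -- The part of the graph hanging from `u` is a decoration of kind `κ`. The edge fields say that
  -- the prescribed edges are present with their signs, the neighbour fields that there are no
  -- others.
  record Local (u : Vtx n) (κ : Kind) : Set where
    field
      dec       : Deco κ → Vtx n
      dec-inj   : ∀ {x y} → dec x ≡ dec y → x ≡ y
      not-core  : ∀ x → ¬ Core (dec x)
      root-edge : ∀ {x z} → LocalEdge κ nothing x z → u ∙ dec x ≡ z
      deco-edge : ∀ {x y z} → LocalEdge κ (just x) y z → dec x ∙ dec y ≡ z
      root-nbrs : ∀ v → ¬ Core v → Adj A u v → ∃ λ x → dec x ≡ v × LocalEdge κ nothing x (u ∙ v)
      deco-nbrs : ∀ x v → Adj A (dec x) v →
                  (v ≡ u × LocalEdge κ nothing x (dec x ∙ v)) ⊎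
                  ∃ λ y → dec y ≡ v × (LocalEdge κ (just x) y (dec x ∙ v) ⊎
                                       LocalEdge κ (just y) x (dec x ∙ v))

  abstract
    -- If a core neighbour of u is joined by −1 then u has no hubs: those would lie between two
    -- core neighbours joined by +1.
    no-hubs : ∀ {u a b} → a ≢ b → CoreEdge u a → CoreEdge u b → u ∙ b ≡ -1ℤ →
              ∀ {v} → u ∙ v ≡ -1ℤ → v ≡ a ⊎ v ≡ b
    no-hubs {u} {a} {b} a≢b ca cb ub {v} uv with negative-hub-or-core {u} {v} uv
    ... | inj₂ cv = core-nbrs {u} {w = v} a≢b ca cb (proj₁ ca , cv , adj⁻ {u} {v} uv)
    ... | inj₁ hv = contradiction (trans (is-a {y} uy cy) (sym (is-a {z} uz cz))) y≢z
      where
      open Around (around {u} {v} (proj₁ ca) hv uv)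
      is-a : ∀ {w} → u ∙ w ≡ 1ℤ → CoreEdge u w → w ≡ a
      is-a {w} uw cw with core-nbrs {u} {w = w} a≢b ca cb cw
      ... | inj₁ e    = e
      ... | inj₂ refl = contradiction ub (⁺≢⁻ {u} {w} uw)

  mixed-of : ∀ {u} e → Leaf e → u ∙ e ≡ 1ℤ →
             (∀ v → ¬ Core v → Adj A u v → e ≡ v × u ∙ v ≡ 1ℤ) → Local u Mixed
  mixed-of {u} e leaf ue only = record
    { dec       = λ _ → e
    ; dec-inj   = λ { {0F} {0F} _ → refl }
    ; not-core  = λ _ → core-not-leaf {e} leaf
    ; root-edge = λ { mx → ue }
    ; deco-edge = λ ()
    ; root-nbrs = λ v ¬c adj → 0F , proj₁ (only v ¬c adj) ,
                    subst (LocalEdge Mixed nothing 0F) (sym (proj₂ (only v ¬c adj))) mx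
    ; deco-nbrs = λ { 0F v adj → inj₁
        ( leaf-unique {e} {v} {u} leaf adj (adj-sym {u} {e} (adj⁺ {u} {e} ue))
        , subst (LocalEdge Mixed nothing 0F) (sym (leaf-edge {e} {v} leaf adj)) mx) }
    }

  negative-of : ∀ {u} (d : Fin 3 → Vtx n) → (∀ {x y} → d x ≡ d y → x ≡ y) → (∀ x → Leaf (d x)) →
                (∀ x → u ∙ d x ≡ 1ℤ) →
                (∀ v → ¬ Core v → Adj A u v → ∃ λ x → d x ≡ v × u ∙ v ≡ 1ℤ) → Local u NN
  negative-of {u} d d-inj leaves ud only = record
    { dec       = d
    ; dec-inj   = d-inj
    ; not-core  = λ x → core-not-leaf {d x} (leaves x)
    ; root-edge = λ { (nn x) → ud x }
    ; deco-edge = λ ()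
    ; root-nbrs = λ v ¬c adj → let x , eq , p = only v ¬c adj in
                    x , eq , subst (LocalEdge NN nothing x) (sym p) (nn x)
    ; deco-nbrs = λ x v adj → inj₁
        ( leaf-unique {d x} {v} {u} (leaves x) adj (adj-sym {u} {d x} (adj⁺ {u} {d x} (ud x)))
        , subst (LocalEdge NN nothing x) (sym (leaf-edge {d x} {v} (leaves x) adj)) (nn x))
    }

  positive-of : ∀ {u} h → Hub h → u ∙ h ≡ -1ℤ → (∀ v → ¬ Core v → Adj A u v → h ≡ v × u ∙ v ≡ -1ℤ) →
                Enum 2 (λ v → h ∙ v ≡ 1ℤ) → Local u PP
  positive-of {u} h h-hub uh only E = record
    { dec       = d
    ; dec-inj   = d-inj
    ; not-core  = λ { 0F → core-not-hub {h} h-hub ; 1F → core-not-leaf {at 0F} (leaves 0F)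
                    ; 2F → core-not-leaf {at 1F} (leaves 1F) }
    ; root-edge = λ { pp-w → uh }
    ; deco-edge = λ { pp-l1 → at-sat 0F ; pp-l2 → at-sat 1F }
    ; root-nbrs = λ v ¬c adj → 0F , proj₁ (only v ¬c adj) ,
                    subst (LocalEdge PP nothing 0F) (sym (proj₂ (only v ¬c adj))) pp-w
    ; deco-nbrs = deco-nbrs
    }
    where
    open Enum E

    leaves : ∀ x → Leaf (at x)
    leaves x = proj₂ h-hub (at x) (at-sat x)

    d : Fin 3 → Vtx n
    d 0F = h
    d 1F = at 0F
    d 2F = at 1F

    h≢at : ∀ x → h ≢ at x
    h≢at x = adj-irrefl {h} {at x} (adj⁺ {h} {at x} (at-sat x))

    d-inj : ∀ {x y} → d x ≡ d y → x ≡ y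
    d-inj {0F} {0F} _ = refl
    d-inj {0F} {1F} e = contradiction e (h≢at 0F)
    d-inj {0F} {2F} e = contradiction e (h≢at 1F)
    d-inj {1F} {0F} e = contradiction (sym e) (h≢at 0F)
    d-inj {1F} {1F} _ = refl
    d-inj {1F} {2F} e with () ← at-inj e
    d-inj {2F} {0F} e = contradiction (sym e) (h≢at 1F)
    d-inj {2F} {1F} e with () ← at-inj e
    d-inj {2F} {2F} _ = refl

    leaf-to-h : ∀ x {v} → Adj A (at x) v → h ≡ v × at x ∙ v ≡ 1ℤ
    leaf-to-h x {v} adj =
      leaf-unique {at x} {h} {v} (leaves x) (adj-sym {h} {at x} (adj⁺ {h} {at x} (at-sat x))) adj ,
      leaf-edge {at x} {v} (leaves x) adj

    deco-nbrs : ∀ x v → Adj A (d x) v →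
                (v ≡ u × LocalEdge PP nothing x (d x ∙ v)) ⊎
                ∃ λ y → d y ≡ v × (LocalEdge PP (just x) y (d x ∙ v) ⊎ LocalEdge PP (just y) x (d x ∙ v))
    deco-nbrs 0F v adj with adj-sign {h} {v} adj
    ... | inj₂ m = inj₁ (hub-unique {h} {v} {u} h-hub m (∙-sym-≡ {u} {h} uh) ,
                         subst (LocalEdge PP nothing 0F) (sym m) pp-w)
    ... | inj₁ p with at-all v p
    ...   | 0F , eq = inj₂ (1F , eq , inj₁ (subst (LocalEdge PP (just 0F) 1F) (sym p) pp-l1))
    ...   | 1F , eq = inj₂ (2F , eq , inj₁ (subst (LocalEdge PP (just 0F) 2F) (sym p) pp-l2))
    deco-nbrs 1F v adj with eq , p ← leaf-to-h 0F {v} adj =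
      inj₂ (0F , eq , inj₂ (subst (LocalEdge PP (just 0F) 1F) (sym p) pp-l1))
    deco-nbrs 2F v adj with eq , p ← leaf-to-h 1F {v} adj =
      inj₂ (0F , eq , inj₂ (subst (LocalEdge PP (just 0F) 2F) (sym p) pp-l2))

  module _ {u a b} (a≢b : a ≢ b) (ca : CoreEdge u a) (cb : CoreEdge u b) where

    private
      cu : Core u
      cu = proj₁ ca

      not-other : ∀ {v} → ¬ Core v → v ≢ a × v ≢ b
      not-other ¬c = (λ { refl → ¬c (proj₁ (proj₂ ca)) }) , λ { refl → ¬c (proj₁ (proj₂ cb)) }

    abstract
      -- No -1 leads to a hub, so `b` is the only one. By balance there are two +1's, `a` and a
      -- further one, which is outside the core and hence a leaf.
      local-mixed : u ∙ a ≡ 1ℤ → u ∙ b ≡ -1ℤ → Local u Mixed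
      local-mixed ua ub = from-enum (positive-enum {u} one-negative)
        where
        is-b : ∀ v → u ∙ v ≡ -1ℤ → v ≡ b
        is-b v uv = [ (λ { refl → contradiction uv (⁺≢⁻ {u} {v} ua) }) , id ]′
                      (no-hubs {u} a≢b ca cb ub {v} uv)

        one-negative : negatives u ≡ 1
        one-negative = enum-size (#-enum (λ v → u ∙ v ℤ.≟ -1ℤ)) record
          { at = λ _ → b ; at-inj = λ { {0F} {0F} _ → refl } ; at-sat = λ _ → ub
          ; at-all = λ v uv → 0F , sym (is-b v uv) }

        from-other : ∀ e → u ∙ e ≡ 1ℤ → a ≢ e → Local u Mixed
        from-other e ue a≢e = mixed-of e e-leaf ue only
          where
          not-core : ¬ Core e
          not-core c = [ (λ eq → a≢e (sym eq)) , (λ { refl → ⁺≢⁻ {u} {b} ue ub }) ]′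
            (core-nbrs {u} {w = e} a≢b ca cb (cu , c , adj⁺ {u} {e} ue))

          e-leaf : Leaf e
          e-leaf = [ id , (λ c → contradiction c not-core) ]′
                     (positive-leaf-or-core {u} {e} (proj₁ cu) ue)

          only : ∀ v → ¬ Core v → Adj A u v → e ≡ v × u ∙ v ≡ 1ℤ
          only v ¬c adj = [ positive , (λ m → contradiction (is-b v m) (proj₂ (not-other ¬c))) ]′
                            (adj-sign {u} {v} adj)
            where
            positive : u ∙ v ≡ 1ℤ → e ≡ v × u ∙ v ≡ 1ℤ
            positive p = [ (λ eq → contradiction eq (proj₁ (not-other ¬c))) , (λ eq → sym eq , p) ]′
                           (two-positives A asm {u} {z = v} one-negative a≢e ua ue p)

        from-enum : Enum 2 (λ v → u ∙ v ≡ 1ℤ) → Local u Mixed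
        from-enum E with a ≟ᵛ Enum.at E 0F
        ... | no a≢  = from-other (Enum.at E 0F) (Enum.at-sat E 0F) a≢
        ... | yes a≡ = from-other (Enum.at E 1F) (Enum.at-sat E 1F)
                         λ a≡′ → case Enum.at-inj E (trans (sym a≡) a≡′) of λ ()

      -- The -1's are exactly `a` and `b`, so there are three +1's. None is core, since `a` and `b`
      -- are the only core neighbours, and all three are leaves.
      local-negative : u ∙ a ≡ -1ℤ → u ∙ b ≡ -1ℤ → Local u NN
      local-negative ua ub = from-enum (positive-enum {u} two-negative)
        where
        is-ab : ∀ v → u ∙ v ≡ -1ℤ → v ≡ a ⊎ v ≡ b
        is-ab v uv = no-hubs {u} a≢b ca cb ub {v} uv

        two-negative : negatives u ≡ 2
        two-negative = enum-size (#-enum (λ v → u ∙ v ℤ.≟ -1ℤ)) record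
          { at     = λ { 0F → a ; 1F → b }
          ; at-inj = λ { {0F} {0F} _ → refl ; {0F} {1F} e → contradiction e a≢b
                       ; {1F} {0F} e → contradiction (sym e) a≢b ; {1F} {1F} _ → refl }
          ; at-sat = λ { 0F → ua ; 1F → ub }
          ; at-all = λ v uv → [ (λ e → 0F , sym e) , (λ e → 1F , sym e) ]′ (is-ab v uv) }

        from-enum : Enum 3 (λ v → u ∙ v ≡ 1ℤ) → Local u NN
        from-enum E = negative-of at at-inj leaves at-sat only
          where
          open Enum E

          leaf-of : ∀ v → u ∙ v ≡ 1ℤ → Leaf v
          leaf-of v uv = [ id , (λ c → contradiction (cu , c , adj⁺ {u} {v} uv) not-core) ]′
                           (positive-leaf-or-core {u} {v} (proj₁ cu) uv)
            where
            not-core : ¬ CoreEdge u v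
            not-core cv = [ (λ { refl → ⁺≢⁻ {u} {v} uv ua }) , (λ { refl → ⁺≢⁻ {u} {v} uv ub }) ]′
                            (core-nbrs {u} {w = v} a≢b ca cb cv)

          leaves : ∀ x → Leaf (at x)
          leaves x = leaf-of (at x) (at-sat x)

          only : ∀ v → ¬ Core v → Adj A u v → ∃ λ x → at x ≡ v × u ∙ v ≡ 1ℤ
          only v ¬c adj =
            [ (λ p → proj₁ (at-all v p) , proj₂ (at-all v p) , p)
            , (λ m → contradiction (is-ab v m) [ proj₁ (not-other ¬c) , proj₂ (not-other ¬c) ]′) ]′
              (adj-sign {u} {v} adj)

      -- Both core neighbours use up +1's, so every -1 of `u` leads to a hub. There is one as `u` is
      -- no leaf, and no second by `hubs-not-ordered`; balance then leaves no +1 besides `a` and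
      -- `b`.
      local-positive : u ∙ a ≡ 1ℤ → u ∙ b ≡ 1ℤ → Local u PP
      local-positive ua ub = from-hub h∃
        where
        negative-hub : ∀ v → u ∙ v ≡ -1ℤ → Hub v
        negative-hub v uv = [ id , (λ c → contradiction (cu , c , adj⁻ {u} {v} uv) not-core) ]′
                              (negative-hub-or-core {u} {v} uv)
          where
          not-core : ¬ CoreEdge u v
          not-core cv = [ (λ { refl → ⁺≢⁻ {u} {v} ua uv }) , (λ { refl → ⁺≢⁻ {u} {v} ub uv }) ]′
                          (core-nbrs {u} {w = v} a≢b ca cb cv)

        h∃ : ∃ λ v → u ∙ v ≡ -1ℤ
        h∃ = #-∃ (λ v → u ∙ v ℤ.≟ -1ℤ) (ℕ.n≢0⇒n>0 (proj₁ cu))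

        from-hub : (∃ λ v → u ∙ v ≡ -1ℤ) → Local u PP
        from-hub (h , uh) = positive-of h h-hub uh only (positive-enum {h} (proj₁ h-hub))
          where
          h-hub : Hub h
          h-hub = negative-hub h uh

          is-h : ∀ v → u ∙ v ≡ -1ℤ → v ≡ h
          is-h v uv with ℕ.<-cmp (ix v) (ix h)
          ... | tri< lt _ _ =
                contradiction lt (hubs-not-ordered {u} {v} {h} cu (negative-hub v uv) uv h-hub uh)
          ... | tri≈ _ e _  = ix-injective {u} (adj⁻ {u} {v} uv) (adj⁻ {u} {h} uh) e
          ... | tri> _ _ gt =
                contradiction gt (hubs-not-ordered {u} {h} {v} cu h-hub uh (negative-hub v uv) uv)

          one-negative : negatives u ≡ 1
          one-negative = enum-size (#-enum (λ v → u ∙ v ℤ.≟ -1ℤ)) record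
            { at = λ _ → h ; at-inj = λ { {0F} {0F} _ → refl } ; at-sat = λ _ → uh
            ; at-all = λ v uv → 0F , sym (is-h v uv) }

          only : ∀ v → ¬ Core v → Adj A u v → h ≡ v × u ∙ v ≡ -1ℤ
          only v ¬c adj =
            [ (λ p → contradiction (two-positives A asm {u} {z = v} one-negative a≢b ua ub p)
                       [ proj₁ (not-other ¬c) , proj₂ (not-other ¬c) ]′)
            , (λ m → sym (is-h v m) , m) ]′ (adj-sign {u} {v} adj)

  local : ∀ x y {u a b} → a ≢ b → CoreEdge u a → CoreEdge u b → u ∙ a ≡ sgn x → u ∙ b ≡ sgn y →
          Local u (kindOf x y)
  local true  true  = local-positive
  local true  false = local-mixed
  local false true  a≢b ca cb ua ub = local-mixed (a≢b ∘ sym) cb ca ub ua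
  local false false = local-negative

  -- The state of a walk that never turns back: the next step depends on the vertex just left as
  -- well as on the present one.
  record Dart : Set where
    field
      tail head : Vtx n
      edge      : CoreEdge tail head

  onward : ∀ {u a} → CoreEdge u a → ∃ λ b → b ≢ a × CoreEdge u b
  onward {u} {a} e with two-core-nbrs {u} (proj₁ e)
  ... | x , y , x≢y , cx , cy with x ≟ᵛ a
  ...   | yes refl = y , x≢y ∘ sym , cy
  ...   | no x≢a   = x , x≢a , cx

  Walk : (ℕ → Vtx n) → Set
  Walk c = (∀ i → CoreEdge (c i) (c (suc i))) × (∀ i → c (suc (suc i)) ≢ c i)

  walk : ∃ Walk
  walk = (λ i → Dart.tail (dart i)) , (λ i → Dart.edge (dart i)) , λ i → turn≢ (dart i)
    where
    ahead : (d : Dart) → let open Dart d in ∃ λ b → b ≢ tail × CoreEdge head b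
    ahead d = onward {head} {tail} (coreEdge-sym {tail} {head} edge)
      where open Dart d

    turn : Dart → Dart
    turn d = record { tail = Dart.head d ; head = proj₁ (ahead d) ; edge = proj₂ (proj₂ (ahead d)) }

    turn≢ : ∀ d → Dart.head (turn d) ≢ Dart.tail d
    turn≢ d = proj₁ (proj₂ (ahead d))

    start : Dart
    start with u , cu ← some-core with a , _ , _ , ca , _ ← two-core-nbrs {u} cu =
      record { tail = u ; head = a ; edge = ca }

    dart : ℕ → Dart
    dart zero    = start
    dart (suc i) = turn (dart i)

-- Closing the walk to an even cycle and reading off the isomorphism

module WalkIn {n} (A : Matrix n) (asm : IsASM A) (conn : Connected A)
              (v₀ : Vtx n) (another : ∀ (i : Fin n) → ∃ λ j → j ≢ i)
              (irreducible : ¬ Graph.Detachable A) (tight : nnz A ≡ 2 * n) where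
  open Irreducible A asm conn v₀ another irreducible
  open Tight tight
  open Unicyclic A asm conn v₀ another irreducible tight

  module _ (c : ℕ → Vtx n) (walking : Walk c) where
    c-edge = proj₁ walking
    c-turn = proj₂ walking

    c-step≢ : ∀ i → c i ≢ c (suc i)
    c-step≢ i = adj-irrefl {c i} {c (suc i)} (proj₂ (proj₂ (c-edge i)))

    c-nbrs : ∀ i {w} → CoreEdge (c (suc i)) w → w ≡ c i ⊎ w ≡ c (suc (suc i))
    c-nbrs i = core-nbrs {c (suc i)} (c-turn i ∘ sym) (coreEdge-sym {c i} (c-edge i)) (c-edge (suc i))

    Distinct : ℕ → Set
    Distinct L = ∀ i j → i < j → j < L → c i ≢ c j

    distinct-injective : ∀ {L} → Distinct L → ∀ (i j : Fin L) → c (toℕ i) ≡ c (toℕ j) → i ≡ j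
    distinct-injective dist i j eq with ℕ.<-cmp (toℕ i) (toℕ j)
    ... | tri< lt _ _ = contradiction eq (dist _ _ lt (Fin.toℕ<n j))
    ... | tri≈ _ e _  = Fin.toℕ-injective e
    ... | tri> _ _ gt = contradiction (sym eq) (dist _ _ gt (Fin.toℕ<n i))

    Repeats : Set
    Repeats = ∃ λ L → Distinct L × ∃ λ i → i < L × c i ≡ c L

    repeat-search : ∀ L → Distinct L ⊎ Repeats
    repeat-search zero = inj₁ λ _ _ _ ()
    repeat-search (suc L) with repeat-search L
    ... | inj₂ r = inj₂ r
    ... | inj₁ dist with Fin.any? (λ (i : Fin L) → c (toℕ i) ≟ᵛ c L)
    ...   | yes (i , eq) = inj₂ (L , dist , toℕ i , Fin.toℕ<n i , eq)
    ...   | no none = inj₁ λ i j i<j j<1+L → case ℕ.m≤n⇒m<n∨m≡n (s≤s⁻¹ j<1+L) of λ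
            { (inj₁ j<L) → dist i j i<j j<L
            ; (inj₂ refl) → λ eq → none (fromℕ< i<j , trans (cong c (Fin.toℕ-fromℕ< i<j)) eq) }

    repeats : Repeats
    -- `# (λ v → v ≟ᵛ v)` counts all vertices, so one more position than that forces a repetition.
    repeats with repeat-search (suc (# (λ v → v ≟ᵛ v)))
    ... | inj₂ r = r
    ... | inj₁ dist = contradiction
          (#-≥ (λ v → v ≟ᵛ v) (c ∘ toℕ) (λ {i} {j} → distinct-injective dist i j) (λ _ → refl))
          ℕ.1+n≰n

    -- The first repetition returns to c 0, as a walk in a 2-regular graph that never turns back
    -- can revisit an inner vertex only through one of its two already visited neighbours.
    returns : ∀ {L} → Distinct L → ∀ i → i < L → c i ≡ c L → i ≡ 0
    returns dist zero i<L eq = refl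
    returns {suc l} dist (suc i) (s≤s i<l) eq =
      contradiction (c-nbrs i (subst (λ v → CoreEdge v (c l)) (sym eq) (coreEdge-sym {c l} (c-edge l))))
        [ (λ e → dist i l i<l (ℕ.n<1+n l) (sym e)) , forward ]′
      where
      -- Here i < l, and the coincidence fails for l > i + 2 by distinctness, for l = i + 2 because
      -- the walk would turn back, and for l = i + 1 because there are no loops.
      forward : c l ≢ c (suc (suc i))
      forward e with ℕ.<-cmp l (suc (suc i))
      ... | tri> _ _ gt = dist (suc (suc i)) l gt (ℕ.n<1+n l) (sym e)
      ... | tri≈ _ refl _ = c-turn (suc i) (sym eq)
      ... | tri< lt _ _ with refl ← ℕ.≤-antisym (s≤s⁻¹ lt) i<l = c-step≢ l e

    isRow : Vtx n → Bool
    isRow (inj₁ _) = true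
    isRow (inj₂ _) = false

    adj-isRow : ∀ {u v} → Adj A u v → isRow v ≡ not (isRow u)
    adj-isRow {inj₁ _} {inj₁ _} adj = contradiction refl adj
    adj-isRow {inj₁ _} {inj₂ _} adj = refl
    adj-isRow {inj₂ _} {inj₁ _} adj = refl
    adj-isRow {inj₂ _} {inj₂ _} adj = contradiction refl adj

    c-isRow : ∀ i → isRow (c (suc i)) ≡ not (isRow (c i))
    c-isRow i = adj-isRow {c i} {c (suc i)} (proj₂ (proj₂ (c-edge i)))

    even-isRow : ∀ m → isRow (c (m + m)) ≡ isRow (c 0)
    even-isRow zero = refl
    even-isRow (suc m) rewrite ℕ.+-suc m m =
      trans (c-isRow (suc (m + m))) (trans (cong not (c-isRow (m + m)))
        (trans (Bool.not-involutive _) (even-isRow m)))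

    even⊎odd : ∀ L → (∃ λ m → L ≡ m + m) ⊎ (∃ λ m → L ≡ suc (m + m))
    even⊎odd zero = inj₁ (0 , refl)
    even⊎odd (suc L) with even⊎odd L
    ... | inj₁ (m , refl) = inj₂ (m , refl)
    ... | inj₂ (m , refl) = inj₁ (suc m , cong suc (sym (ℕ.+-suc m m)))

    -- Rows and columns alternate along the walk, so the first return takes an even number of steps.
    -- Two steps would be turning back, which leaves lengths of the form 2(k + 2).
    cycle : ∃ λ k → Distinct (cycLen k) × c (cycLen k) ≡ c 0
    cycle with repeats
    ... | L , dist , i , i<L , eq with refl ← returns dist i i<L eq = shape (even⊎odd L) dist i<L (sym eq)
      where
      shape : ∀ {L} → (∃ λ m → L ≡ m + m) ⊎ (∃ λ m → L ≡ suc (m + m)) →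
              Distinct L → 0 < L → c L ≡ c 0 → ∃ λ k → Distinct (cycLen k) × c (cycLen k) ≡ c 0
      shape (inj₁ (suc zero , refl))    _    _ eq = contradiction eq (c-turn 0)
      shape (inj₁ (suc (suc k) , refl)) dist _ eq = k , dist , eq
      shape (inj₂ (m , refl))           _    _ eq = contradiction
        (trans (cong isRow (sym eq)) (trans (c-isRow (m + m)) (cong not (even-isRow m))))
        (Bool.not-¬ refl)

  -- The cycle `C` and its decorations are taken as data, so that the isomorphism rests on local
  -- facts and connectedness alone. Only `Φ` is given explicitly; its inverse comes from
  -- surjectivity.
  module Assembly
    (k : ℕ) (s : Fin (cycLen k) → Bool) (C : Fin (cycLen k) → Vtx n)
    (C-inj  : ∀ {t t′} → C t ≡ C t′ → t ≡ t′)
    (C-core : ∀ t → Core (C t))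
    (C-sign : ∀ t → C t ∙ C (next k t) ≡ sgn (s t))
    (C-sign-prev : ∀ t → C t ∙ C (prev k t) ≡ sgn (s (prev k t)))
    (C-nbrs : ∀ t w → Core w → Adj A (C t) w → w ≡ C (prev k t) ⊎ w ≡ C (next k t))
    (around : ∀ t → Local (C t) (kind k s t)) where

    open module Deco t = Local (around t)

    Φ : TVtx k s → Vtx n
    Φ (inj₁ t)       = C t
    Φ (inj₂ (t , x)) = dec t x

    Φ-edge : ∀ {a b z} → TEdge k s a b z → Φ a ∙ Φ b ≡ z
    Φ-edge (cyc t)           = C-sign t
    Φ-edge (hub t x z e)     = root-edge t e
    Φ-edge (inner t x y z e) = deco-edge t e

    Φ-adj : ∀ {a b z} → TAdj k s a b z → Φ a ∙ Φ b ≡ z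
    Φ-adj (inj₁ e) = Φ-edge e
    Φ-adj {a} {b} (inj₂ e) = ∙-sym-≡ {Φ b} {Φ a} (Φ-edge e)

    Φ-nbrs : ∀ a v → Adj A (Φ a) v → ∃ λ b → Φ b ≡ v × TAdj k s a b (Φ a ∙ v)
    Φ-nbrs (inj₁ t) v adj = by-core (core? v)
      where
      by-core : Dec (Core v) → ∃ λ b → Φ b ≡ v × TAdj k s (inj₁ t) b (C t ∙ v)
      by-core (no ¬c) with x , eq , e ← root-nbrs t v ¬c adj = inj₂ (t , x) , eq , inj₁ (hub t x _ e)
      by-core (yes c) = [ backward , forward ]′ (C-nbrs t v c adj)
        where
        forward : v ≡ C (next k t) → ∃ λ b → Φ b ≡ v × TAdj k s (inj₁ t) b (C t ∙ v)
        forward refl = inj₁ (next k t) , refl , inj₁ (subst (TEdge k s _ _) (sym (C-sign t)) (cyc t))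

        backward : v ≡ C (prev k t) → ∃ λ b → Φ b ≡ v × TAdj k s (inj₁ t) b (C t ∙ v)
        backward refl = inj₁ (prev k t) , refl , inj₂
          (subst₂ (λ t′ z → TEdge k s (inj₁ (prev k t)) (inj₁ t′) z)
            (next-prev k t) (sym (C-sign-prev t)) (cyc (prev k t)))
    Φ-nbrs (inj₂ (t , x)) v adj with deco-nbrs t x v adj
    ... | inj₁ (refl , e)         = inj₁ t , refl , inj₂ (hub t x _ e)
    ... | inj₂ (y , eq , inj₁ e)  = inj₂ (t , y) , eq , inj₁ (inner t x y _ e)
    ... | inj₂ (y , eq , inj₂ e)  = inj₂ (t , y) , eq , inj₂ (inner t y x _ e)

    -- By `Φ-nbrs` the image of `Φ` is closed under passing to neighbours, and the graph is
    -- connected.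
    Φ-onto : ∀ v → ∃ λ a → Φ a ≡ v
    Φ-onto v = along (conn (C zero) v) (inj₁ zero) refl
      where
      along : ∀ {x y} → Star (Adj A) x y → ∀ a → Φ a ≡ x → ∃ λ b → Φ b ≡ y
      along ε a eq = a , eq
      along (adj ◅ path) a refl with b , eq , _ ← Φ-nbrs a _ adj = along path b eq

    dec≢C : ∀ {t x t′} → dec t x ≢ C t′
    dec≢C {t} {x} {t′} eq = not-core t x (subst Core (sym eq) (C-core t′))

    root-unique : ∀ {t x t′} → Adj A (dec t x) (C t′) → t ≡ t′
    root-unique {t} {x} {t′} adj with deco-nbrs t x (C t′) adj
    ... | inj₁ (eq , _)     = C-inj (sym eq)
    ... | inj₂ (y , eq , _) = contradiction eq dec≢C

    root-adj : ∀ {t x z} → z ≢ 0ℤ → LocalEdge (kind k s t) nothing x z → Adj A (dec t x) (C t)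
    root-adj {t} {x} z≢0 e eq = z≢0 (trans (sym (root-edge t e)) (∙-sym-≡ {dec t x} {C t} eq))

    -- Climbing from a decoration reaches the cycle after at most two steps. A vertex decorating
    -- both `t` and `t′` is either adjacent to `C t` itself or adjacent to a decoration that is, and
    -- `root-unique` then identifies the two roots.
    dec-root : ∀ {t x t′ x′} → dec t x ≡ dec t′ x′ → t ≡ t′
    dec-root {t} {x} {t′} {x′} eq = by-parent (localParent (kind k s t) x) refl
      (proj₁ (proj₂ (parent-localEdge (kind k s t) x))) (proj₂ (proj₂ (parent-localEdge (kind k s t) x)))
      where
      by-parent : ∀ m {z} → localParent (kind k s t) x ≡ m → z ≢ 0ℤ →
                  LocalEdge (kind k s t) (localParent (kind k s t) x) x z → t ≡ t′
      by-parent nothing {z} par z≢0 e = sym (root-unique {t′} {x′} (subst (λ v → Adj A v (C t)) eq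
        (root-adj {t} {x} z≢0 (subst (λ m → LocalEdge (kind k s t) m x z) par e))))
      by-parent (just y) {z} par z≢0 e
        with deco-nbrs t′ x′ (dec t y) (subst (λ v → Adj A v (dec t y)) eq (adj-sym {dec t y} {dec t x}
               (λ q → z≢0 (trans (sym (deco-edge t (subst (λ m → LocalEdge (kind k s t) m x z) par e))) q))))
      ... | inj₁ (eq′ , _)      = contradiction eq′ dec≢C
      ... | inj₂ (y′ , eq′ , _) with w , w≢0 , e′ ← parent-localEdge (kind k s t) y =
            sym (root-unique {t′} {y′} (subst (λ v → Adj A v (C t)) (sym eq′) (root-adj {t} {y} w≢0
              (subst (λ m → LocalEdge (kind k s t) m y w) (parent-of-parent (kind k s t) par) e′))))

    Φ-inj : ∀ a b → Φ a ≡ Φ b → a ≡ b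
    Φ-inj (inj₁ t) (inj₁ t′) eq = cong inj₁ (C-inj eq)
    Φ-inj (inj₁ t) (inj₂ (t′ , x)) eq = contradiction (sym eq) dec≢C
    Φ-inj (inj₂ (t , x)) (inj₁ t′) eq = contradiction eq dec≢C
    Φ-inj (inj₂ (t , x)) (inj₂ (t′ , x′)) eq with refl ← dec-root {t} {x} {t′} {x′} eq =
      cong (λ y → inj₂ (t , y)) (dec-inj t eq)

    Ψ : Vtx n → TVtx k s
    Ψ v = proj₁ (Φ-onto v)

    ΦΨ : ∀ v → Φ (Ψ v) ≡ v
    ΦΨ v = proj₂ (Φ-onto v)

    unicyclic : IsBasicUnicyclic A
    unicyclic = record
      { isASM = asm ; k = k ; s = s
      ; iso   = mk↔ₛ′ Ψ Φ (λ a → Φ-inj _ _ (ΦΨ (Φ a))) ΦΨ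
      ; edges = λ u v z z≢0 → mk⇔ (edge-to u v z z≢0)
                  (λ adj → trans (cong₂ _∙_ (sym (ΦΨ u)) (sym (ΦΨ v))) (Φ-adj adj))
      }
      where
      edge-to : ∀ u v z → z ≢ 0ℤ → u ∙ v ≡ z → TAdj k s (Ψ u) (Ψ v) z
      edge-to u v z z≢0 eq = conclude (Φ-nbrs (Ψ u) v (λ q → z≢0 (trans (sym eq′) q)))
        where
        eq′ : Φ (Ψ u) ∙ v ≡ z
        eq′ = trans (cong (_∙ v) (ΦΨ u)) eq

        conclude : (∃ λ b → Φ b ≡ v × TAdj k s (Ψ u) b (Φ (Ψ u) ∙ v)) → TAdj k s (Ψ u) (Ψ v) z
        conclude (b , Φb , adj) =
          subst₂ (TAdj k s (Ψ u)) (Φ-inj b (Ψ v) (trans Φb (sym (ΦΨ v)))) eq′ adj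

  module Closing (c : ℕ → Vtx n) (walking : Walk c) (k : ℕ)
                 (dist : Distinct c walking (cycLen k)) (closed : c (cycLen k) ≡ c 0) where

    C : Fin (cycLen k) → Vtx n
    C t = c (toℕ t)

    C-edge : ∀ t → CoreEdge (C t) (C (next k t))
    C-edge t = subst (CoreEdge (C t)) (sym C-next) (proj₁ walking (toℕ t))
      where
      C-next : C (next k t) ≡ c (suc (toℕ t))
      C-next with next-toℕ k t
      ... | inj₁ (_ , e)  = cong c e
      ... | inj₂ (l , e) = trans (cong c e) (trans (sym closed) (cong c (sym l)))

    C-edge-prev : ∀ t → CoreEdge (C t) (C (prev k t))
    C-edge-prev t = coreEdge-sym {C (prev k t)} {C t}
      (subst (λ t′ → CoreEdge (C (prev k t)) (C t′)) (next-prev k t) (C-edge (prev k t)))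

    C-inj : ∀ {t t′} → C t ≡ C t′ → t ≡ t′
    C-inj {t} {t′} = distinct-injective c walking dist t t′

    prev≢next : ∀ t → C (prev k t) ≢ C (next k t)
    prev≢next t eq = next-next≢ k t (trans (cong (next k) (sym (C-inj eq))) (next-prev k t))

    s : Fin (cycLen k) → Bool
    s t = does (C t ∙ C (next k t) ℤ.≟ 1ℤ)

    C-sign : ∀ t → C t ∙ C (next k t) ≡ sgn (s t)
    C-sign t with C t ∙ C (next k t) ℤ.≟ 1ℤ
    ... | yes p = p
    ... | no ¬p = [ (λ p → contradiction p ¬p) , id ]′
                    (adj-sign {C t} {C (next k t)} (proj₂ (proj₂ (C-edge t))))

    C-sign-prev : ∀ t → C t ∙ C (prev k t) ≡ sgn (s (prev k t))
    C-sign-prev t = ∙-sym-≡ {C (prev k t)} {C t}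
      (trans (cong (λ t′ → C (prev k t) ∙ C t′) (sym (next-prev k t))) (C-sign (prev k t)))

    unicyclic : IsBasicUnicyclic A
    unicyclic = Assembly.unicyclic k s C C-inj (λ t → proj₁ (C-edge t)) C-sign C-sign-prev
      (λ t w cw adj → core-nbrs {C t} {w = w} (prev≢next t) (C-edge-prev t) (C-edge t)
                        (proj₁ (C-edge t) , cw , adj))
      (λ t → local (s (prev k t)) (s t) (prev≢next t) (C-edge-prev t) (C-edge t)
               (C-sign-prev t) (C-sign t))

  tight⇒unicyclic : IsBasicUnicyclic A
  tight⇒unicyclic with c , walking ← walk with k , dist , closed ← cycle c walking =
    Closing.unicyclic c walking k dist closed

-- Extremal examples

nz-zero : ∀ n → nz {n} (λ _ → 0ℤ) ≡ []
nz-zero zero    = refl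
nz-zero (suc n) = nz-zero n

connected-through : ∀ {n} (A : Matrix n) root → (∀ v → Star (Adj A) v root) → Connected A
connected-through A root to-root u v =
  to-root u ◅◅ reverse (λ {x} {y} → Graph.adj-sym A {x} {y}) (to-root v)

-- D₃ attached in the top left corner, at a fictitious +1 at the top of the first column of A: the
-- resulting column 1, −1 followed by the first column of A alternates whatever the latter is.
extend : ∀ {m} → Matrix (suc m) → Matrix (suc (suc (suc m)))
extend A 0F            1F                  = 1ℤ
extend A 0F            _                   = 0ℤ
extend A 1F            0F                  = 1ℤ
extend A 1F            1F                  = -1ℤ
extend A 1F            2F                  = 1ℤ
extend A 1F            _                   = 0ℤ
extend A (suc (suc i)) 0F                  = 0ℤ
extend A (suc (suc i)) 1F                  = A i zero
extend A (suc (suc i)) 2F                  = 0ℤ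
extend A (suc (suc i)) (suc (suc (suc j))) = A i (suc j)

module _ {m} (A : Matrix (suc m)) where

  extend-row₀ : nz (extend A 0F) ≡ 1ℤ ∷ []
  extend-row₀ = cong (1ℤ ∷_) (nz-zero m)

  extend-row₁ : nz (extend A 1F) ≡ 1ℤ ∷ -1ℤ ∷ 1ℤ ∷ []
  extend-row₁ = cong (λ xs → 1ℤ ∷ -1ℤ ∷ 1ℤ ∷ xs) (nz-zero m)

  extend-row : ∀ i → nz (extend A (suc (suc i))) ≡ nz (A i)
  extend-row i = nonzeros-∷-cong (A i zero) refl

  extend-nnz : nnz (extend A) ≡ 4 + nnz A
  extend-nnz = cong₂ _+_ (cong length extend-row₀) (cong₂ _+_ (cong length extend-row₁)
    (cong sum (List.tabulate-cong (λ i → cong length (extend-row i)))))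

  extend-asm : IsASM A → IsASM (extend A)
  extend-asm asm = record { entries = entries′ ; rowsAlt = rowsAlt′ ; colsAlt = colsAlt′ }
    where
    open IsASM asm

    entries′ : ∀ i j → extend A i j ≡ 0ℤ ⊎ extend A i j ≡ 1ℤ ⊎ extend A i j ≡ -1ℤ
    entries′ 0F            0F                  = inj₁ refl
    entries′ 0F            1F                  = inj₂ (inj₁ refl)
    entries′ 0F            (suc (suc j))       = inj₁ refl
    entries′ 1F            0F                  = inj₂ (inj₁ refl)
    entries′ 1F            1F                  = inj₂ (inj₂ refl)
    entries′ 1F            2F                  = inj₂ (inj₁ refl)
    entries′ 1F            (suc (suc (suc j))) = inj₁ refl
    entries′ (suc (suc i)) 0F                  = inj₁ refl
    entries′ (suc (suc i)) 1F                  = entries i zero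
    entries′ (suc (suc i)) 2F                  = inj₁ refl
    entries′ (suc (suc i)) (suc (suc (suc j))) = entries i (suc j)

    rowsAlt′ : ∀ i → Alternating (nz (extend A i))
    rowsAlt′ 0F            = subst Alternating (sym extend-row₀) single
    rowsAlt′ 1F            = subst Alternating (sym extend-row₁) (more single)
    rowsAlt′ (suc (suc i)) = subst Alternating (sym (extend-row i)) (rowsAlt i)

    colsAlt′ : ∀ j → Alternating (nz (λ i → extend A i j))
    colsAlt′ 0F                  = subst (λ xs → Alternating (1ℤ ∷ xs)) (sym (nz-zero (suc m))) single
    colsAlt′ 1F                  = more (colsAlt zero)
    colsAlt′ 2F                  = subst (λ xs → Alternating (1ℤ ∷ xs)) (sym (nz-zero (suc m))) single
    colsAlt′ (suc (suc (suc j))) = colsAlt (suc j)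

  extend-connected : Connected A → Connected (extend A)
  extend-connected conn = connected-through (extend A) (inj₂ 1F) to-root
    where
    embed : Vtx (suc m) → Vtx (suc (suc (suc m)))
    embed (inj₁ i)       = inj₁ (suc (suc i))
    embed (inj₂ zero)    = inj₂ 1F
    embed (inj₂ (suc j)) = inj₂ (suc (suc (suc j)))

    BG-embed : ∀ u v → BG (extend A) (embed u) (embed v) ≡ BG A u v
    BG-embed (inj₁ _)       (inj₁ _)       = refl
    BG-embed (inj₁ _)       (inj₂ zero)    = refl
    BG-embed (inj₁ _)       (inj₂ (suc _)) = refl
    BG-embed (inj₂ zero)    (inj₁ _)       = refl
    BG-embed (inj₂ (suc _)) (inj₁ _)       = refl
    BG-embed (inj₂ zero)    (inj₂ zero)    = refl
    BG-embed (inj₂ zero)    (inj₂ (suc _)) = refl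
    BG-embed (inj₂ (suc _)) (inj₂ zero)    = refl
    BG-embed (inj₂ (suc _)) (inj₂ (suc _)) = refl

    old : ∀ v → Star (Adj (extend A)) (embed v) (inj₂ 1F)
    old v = gmap embed (λ {x} {y} adj eq → adj (trans (sym (BG-embed x y)) eq)) (conn v (inj₂ zero))

    to-root : ∀ v → Star (Adj (extend A)) v (inj₂ 1F)
    to-root (inj₁ 0F)                  = (λ ()) ◅ ε
    to-root (inj₁ 1F)                  = (λ ()) ◅ ε
    to-root (inj₁ (suc (suc i)))       = old (inj₁ i)
    to-root (inj₂ 0F)                  = _◅_ {j = inj₁ 1F} (λ ()) ((λ ()) ◅ ε)
    to-root (inj₂ 1F)                  = ε
    to-root (inj₂ 2F)                  = _◅_ {j = inj₁ 1F} (λ ()) ((λ ()) ◅ ε)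
    to-root (inj₂ (suc (suc (suc j)))) = old (inj₂ (suc j))

-- A basic unicyclic matrix of least size: the signs alternate around the 4-cycle on rows and
-- columns `1F` and `2F`, so each cycle vertex is mixed and bears a single leaf.
cyclic₄ : Matrix 4
cyclic₄ 0F 1F = 1ℤ
cyclic₄ 1F 0F = 1ℤ
cyclic₄ 1F 1F = -1ℤ
cyclic₄ 1F 2F = 1ℤ
cyclic₄ 2F 1F = 1ℤ
cyclic₄ 2F 2F = -1ℤ
cyclic₄ 2F 3F = 1ℤ
cyclic₄ 3F 2F = 1ℤ
cyclic₄ _  _  = 0ℤ

cyclic₄-asm : IsASM cyclic₄
cyclic₄-asm = record
  { entries = entries′
  ; rowsAlt = λ { 0F → single ; 1F → more single ; 2F → more single ; 3F → single }
  ; colsAlt = λ { 0F → single ; 1F → more single ; 2F → more single ; 3F → single }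
  }
  where
  entries′ : ∀ i j → cyclic₄ i j ≡ 0ℤ ⊎ cyclic₄ i j ≡ 1ℤ ⊎ cyclic₄ i j ≡ -1ℤ
  entries′ 0F 0F = inj₁ refl
  entries′ 0F 1F = inj₂ (inj₁ refl)
  entries′ 0F 2F = inj₁ refl
  entries′ 0F 3F = inj₁ refl
  entries′ 1F 0F = inj₂ (inj₁ refl)
  entries′ 1F 1F = inj₂ (inj₂ refl)
  entries′ 1F 2F = inj₂ (inj₁ refl)
  entries′ 1F 3F = inj₁ refl
  entries′ 2F 0F = inj₁ refl
  entries′ 2F 1F = inj₂ (inj₁ refl)
  entries′ 2F 2F = inj₂ (inj₂ refl)
  entries′ 2F 3F = inj₂ (inj₁ refl)
  entries′ 3F 0F = inj₁ refl
  entries′ 3F 1F = inj₁ refl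
  entries′ 3F 2F = inj₂ (inj₁ refl)
  entries′ 3F 3F = inj₁ refl

cyclic₄-connected : Connected cyclic₄
cyclic₄-connected = connected-through cyclic₄ (inj₂ 1F) to-root
  where
  to-root : ∀ v → Star (Adj cyclic₄) v (inj₂ 1F)
  to-root (inj₁ 0F) = (λ ()) ◅ ε
  to-root (inj₁ 1F) = (λ ()) ◅ ε
  to-root (inj₁ 2F) = (λ ()) ◅ ε
  to-root (inj₁ 3F) = _◅_ {j = inj₂ 2F} (λ ()) (_◅_ {j = inj₁ 1F} (λ ()) ((λ ()) ◅ ε))
  to-root (inj₂ 0F) = _◅_ {j = inj₁ 1F} (λ ()) ((λ ()) ◅ ε)
  to-root (inj₂ 1F) = ε
  to-root (inj₂ 2F) = _◅_ {j = inj₁ 1F} (λ ()) ((λ ()) ◅ ε)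
  to-root (inj₂ 3F) = _◅_ {j = inj₁ 2F} (λ ()) ((λ ()) ◅ ε)

I₁-asm : IsASM I₁
I₁-asm = record
  { entries = λ _ _ → inj₂ (inj₁ refl) ; rowsAlt = λ { 0F → single } ; colsAlt = λ { 0F → single } }

I₁-connected : Connected I₁
I₁-connected = connected-through I₁ (inj₂ 0F) λ { (inj₁ 0F) → (λ ()) ◅ ε ; (inj₂ 0F) → ε }

odd-example : ∀ n → n % 2 ≡ 1 → Σ (Matrix n) λ A → ConnectedASM A × nnz A ≡ 2 * n ∸ 1
odd-example 1 _ = I₁ , (I₁-asm , I₁-connected) , refl
odd-example (suc (suc (suc m))) odd with A , (asm , conn) , eq ← odd-example (suc m) odd =
  extend A , (extend-asm A asm , extend-connected A conn) ,
  trans (extend-nnz A) (trans (cong (λ z → 4 + z) eq)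
    (solve 1 (λ m → con 4 :+ (m :+ (con 1 :+ m :+ con 0)) :=
                    con 2 :+ m :+ (con 3 :+ m :+ con 0)) refl m))
  where open +-*-Solver

even-example : ∀ n → 1 ≤ n → n ≢ 2 → n % 2 ≡ 0 → Σ (Matrix n) λ A → ConnectedASM A × nnz A ≡ 2 * n
even-example 2 _ n≢2 _ = contradiction refl n≢2
even-example 4 _ _ _ = cyclic₄ , (cyclic₄-asm , cyclic₄-connected) , refl
even-example (suc (suc (suc (suc (suc m))))) _ _ even
  with A , (asm , conn) , eq ← even-example (suc (suc (suc m))) (s≤s z≤n) (λ ()) even =
  extend A , (extend-asm A asm , extend-connected A conn) ,
  trans (extend-nnz A) (trans (cong (λ z → 4 + z) eq)
    (solve 1 (λ n → con 4 :+ con 2 :* n := con 2 :* (con 2 :+ n)) refl (suc (suc (suc m)))))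
  where open +-*-Solver

-- Classification

attachSeq-I₁-odd : ∀ {n} {A : Matrix n} → AttachSeq I₁ n A → n % 2 ≡ 1
attachSeq-I₁-odd (base _)     = refl
attachSeq-I₁-odd (step seq _) = attachSeq-I₁-odd seq

attachSeq-I₁-nnz : ∀ {n} {A : Matrix n} → AttachSeq I₁ n A → nnz A ≡ 2 * n ∸ 1
-- The invariant reads nnz A + 2 = 1 + 2n. Taking 2 from both sides turns the right one into
-- `2 * n ∸ 1` by computation.
attachSeq-I₁-nnz {n} {A} seq = cong (λ z → z ∸ 2) (trans (ℕ.+-comm 2 (nnz A)) (attachSeq-nnz seq))

FromUnicyclic : ∀ {n} → Matrix n → Set
FromUnicyclic {n} A = Σ ℕ (λ m → Σ (Matrix m) (λ B → IsBasicUnicyclic B × AttachSeq B n A))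

fromUnicyclic-nnz : ∀ {n} {A : Matrix n} → FromUnicyclic A → nnz A ≡ 2 * n
fromUnicyclic-nnz {n} {A} (m , B , uni , seq) = ℕ.+-cancelʳ-≡ (2 * m) (nnz A) (2 * n)
  (trans (attachSeq-nnz seq) (trans (cong (λ z → z + 2 * n) (unicyclic-nnz uni)) (ℕ.+-comm (2 * m) (2 * n))))

one-by-one : ∀ (A : Matrix 1) → IsASM A → A 0F 0F ≡ 1ℤ
one-by-one A asm with A 0F 0F | IsASM.rowsAlt asm 0F
... | nonneg zero    | ()
... | nonneg (suc _) | a = alt-head a
... | -[1+ _ ]       | a with () ← alt-head a

-- The bound and its equality case travel together because an attachment raises both `nnz A` and
-- `2 * n` by 4. The first alternative has nnz = 2n - 1, so the two exclude each other.
Classified : ∀ {n} → Matrix n → Set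
Classified {n} A = AttachSeq I₁ n A ⊎ (2 * n ≤ nnz A × (nnz A ≡ 2 * n → FromUnicyclic A))

classified-irreducible : ∀ {n} (A : Matrix n) → ConnectedASM A → Vtx n →
                         (∀ (i : Fin n) → ∃ λ j → j ≢ i) → ¬ Graph.Detachable A → Classified A
classified-irreducible {n} A (asm , conn) v₀ another irreducible = inj₂
  ( Irreducible.nnz-bound A asm conn v₀ another irreducible
  , λ tight → n , A , WalkIn.tight⇒unicyclic A asm conn v₀ another irreducible tight ,
              base (λ _ _ → refl) )

classified-attach : ∀ {n} {A : Matrix n} {B : Matrix (suc (suc n))} →
                    Classified A → AttachD₃ A B → Classified B
classified-attach (inj₁ seq) att = inj₁ (step seq att)
classified-attach {n} {A} {B} (inj₂ (bound , from)) att = inj₂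
  ( subst₂ _≤_ (sym double) (sym (attach-nnz att)) (ℕ.+-monoʳ-≤ 4 bound)
  , λ tight → let k , C , uni , seq = from (ℕ.+-cancelˡ-≡ 4 (nnz A) (2 * n)
                    (trans (sym (attach-nnz att)) (trans tight double)))
              in k , C , uni , step seq att )
  where
  double : 2 * suc (suc n) ≡ 4 + 2 * n
  double = solve 1 (λ n → con 2 :* (con 2 :+ n) := con 4 :+ con 2 :* n) refl n
    where open +-*-Solver

classify : ∀ m (A : Matrix (suc m)) → ConnectedASM A → Classified A
classify zero    A (asm , _) = inj₁ (base λ { 0F 0F → one-by-one A asm })
classify (suc m) A casm = by-detaching m A casm (Graph.detachable? A)
  where
  by-detaching : ∀ m (A : Matrix (suc (suc m))) → ConnectedASM A → Dec (Graph.Detachable A) → Classified A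
  by-detaching m A casm (no irreducible) = classified-irreducible A casm (inj₁ zero)
    (λ i → punchIn i zero , Fin.punchInᵢ≢i i zero) irreducible
  -- Detaching from a 2 × 2 matrix would leave the empty matrix, which has no entry to which `D₃`
  -- could have been attached.
  by-detaching zero    A casm (yes d) with () ← AttachD₃.i (proj₂ (proj₂ (detach A casm d)))
  by-detaching (suc m) A casm (yes d) =
    let B , casm′ , att = detach A casm d in classified-attach (classify m B casm′) att

even≢odd : ∀ {n} → n % 2 ≡ 0 → n % 2 ≢ 1
even≢odd even odd with () ← trans (sym even) odd

theorem3p1 : (n : ℕ) → 1 ≤ n → n ≢ 2 →
    ((n % 2 ≡ 1 → IsMinNNZ n (2 * n ∸ 1)) × (n % 2 ≡ 0 → IsMinNNZ n (2 * n)))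
    × (n % 2 ≡ 1 → (A : Matrix n) → ConnectedASM A →
    (nnz A ≡ 2 * n ∸ 1) ⇔ AttachSeq I₁ n A)
    × (n % 2 ≡ 0 → (A : Matrix n) → ConnectedASM A →
    (nnz A ≡ 2 * n) ⇔
    Σ ℕ (λ m → Σ (Matrix m) (λ B → IsBasicUnicyclic B × AttachSeq B n A)))
theorem3p1 n@(suc m) 1≤n n≢2 =
  ( (λ odd → odd-example n odd , odd-bound)
  , (λ even → even-example n 1≤n n≢2 even , even-bound even) )
  , (λ _ A casm → mk⇔ (tree A casm) attachSeq-I₁-nnz)
  , (λ even A casm → mk⇔ (unicyclic even A casm) fromUnicyclic-nnz)
  where
  odd-bound : (A : Matrix n) → ConnectedASM A → 2 * n ∸ 1 ≤ nnz A
  odd-bound A casm with classify m A casm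
  ... | inj₁ seq         = ℕ.≤-reflexive (sym (attachSeq-I₁-nnz seq))
  ... | inj₂ (bound , _) = ℕ.≤-trans (ℕ.m∸n≤m (2 * n) 1) bound

  even-bound : n % 2 ≡ 0 → (A : Matrix n) → ConnectedASM A → 2 * n ≤ nnz A
  even-bound even A casm with classify m A casm
  ... | inj₁ seq         = contradiction (attachSeq-I₁-odd seq) (even≢odd {n} even)
  ... | inj₂ (bound , _) = bound

  tree : (A : Matrix n) → ConnectedASM A → nnz A ≡ 2 * n ∸ 1 → AttachSeq I₁ n A
  tree A casm eq with classify m A casm
  ... | inj₁ seq         = seq
  ... | inj₂ (bound , _) = contradiction (subst (2 * n ≤_) eq bound) ℕ.1+n≰n

  unicyclic : n % 2 ≡ 0 → (A : Matrix n) → ConnectedASM A → nnz A ≡ 2 * n → FromUnicyclic A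
  unicyclic even A casm eq with classify m A casm
  ... | inj₁ seq        = contradiction (attachSeq-I₁-odd seq) (even≢odd {n} even)
  ... | inj₂ (_ , from) = from eq
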